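{- Let $T$ be a nontrivial tree (at least two vertices) of order $n(T)$ with $l(T)$ leaves. Then $$\gamma^{d}_2(T)\geq \frac{n(T)-l(T)+3}{4},$$ with equality if and only if there is a labeling $S$ of $T$ such that $(T,S)\in\mathscr{T}_1$.
   Context: Graphs are finite and simple. For a vertex $v$ of a graph $G$, $N(v)$ is its open neighborhood, $N[v]=N(v)\cup\{v\}$, $d(v)=|N(v)|$, and $d(u,v)$ denotes distance. A leaf is a vertex of degree $1$; a support vertex is a vertex adjacent to a leaf. For a tree $T$, $l(T)$ and $s(T)$ denote the numbers of leaves and of support vertices, and $n(T)$ its order. A set $D\subseteq V(G)$ is a disjunctive dominating set ($2DD$-set) of $G$ if every vertex $v\notin D$ either has a neighbor in $D$ or has at least two vertices of $D$ at distance exactly $2$ from it; a vertex $v$ is said to be $2D$-dominated by $D$ if $N[v]\cap D\neq\emptyset$ or at least two vertices of $D$ are at distance $2$ from $v$. The disjunctive domination number $\gamma^{d}_2(G)$ is the minimum size of a $2DD$-set; a $2DD$-set of that size is a $\gamma^d_2$-set. Labeled trees: a labeling of a tree $T$ is a partition $S=(S_A,S_B,S_C,S_D)$ of $V(T)$ into four (possibly empty) sets; the status $\mathrm{sta}(v)\in\{A,B,C,D\}$ is the letter $x$ with $v\in S_x$. Operation $\mathscr{O}_1$: choose a vertex $v$ with $\mathrm{sta}(v)=A$; add a new vertex $u$ and the edge $uv$, with $\mathrm{sta}(u)=C$. Operation $\mathscr{O}_3$: choose a vertex $v$ with $\mathrm{sta}(v)=C$ and $d(v)=1$; add a new path $u_1u_2u_3u_4$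 and the edge $u_1v$, with $\mathrm{sta}(u_1)=D$, $\mathrm{sta}(u_2)=B$, $\mathrm{sta}(u_3)=A$, $\mathrm{sta}(u_4)=C$. (Existing vertices keep their statuses.) $\mathscr{T}_1$ is the smallest family of labeled trees that contains $(P_3,S')$, where $S'$ gives both leaves of $P_3$ status $C$ and the central vertex status $A$, and is closed under $\mathscr{O}_1$ and $\mathscr{O}_3$. -}

module Defs where

open import Data.Empty using (⊥; ⊥-elim)
open import Data.Fin.Base using (Fin; zero; suc; toℕ)
open import Data.Fin.Patterns using (0F; 1F; 2F)
open import Data.Fin.Permutation using (Permutation′; _⟨$⟩ʳ_)
open import Data.Fin.Properties using (_≟_; any?; all?)
open import Data.Fin.Subset using (Subset; _∈_; _∉_; ∣_∣; ⊤)
open import Data.Fin.Subset.Properties using (_∈?_; anySubset?; ∈⊤)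
open import Data.List.Base using (List; []; _∷_)
open import Data.List.Relation.Unary.Unique.Propositional using (Unique)
open import Data.Nat.Base using (ℕ; zero; suc; _≤_; z≤n; s≤s)
open import Data.Nat.Properties as ℕₚ using (≮⇒≥; <⇒≱; allUpTo?)
open import Data.Product using (Σ-syntax; ∃; ∃-syntax; ∃₂; _×_; _,_; proj₁; proj₂)
open import Data.Sum using (_⊎_; inj₁; inj₂; swap)
open import Data.Vec.Base using (tabulate)
open import Function.Base using (_∘_)
open import Function.Bundles using (_⇔_)
open import Level using (0ℓ)
open import Relation.Binary.Construct.Closure.ReflexiveTransitive using (Star; ε; _◅_)
open import Relation.Binary.Core using (Rel)
import Relation.Binary.Definitions as B
open import Relation.Binary.PropositionalEquality using (_≡_; _≢_; refl; cong)
open import Relation.Nullary using (Dec; yes; no; does; ¬_)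
open import Relation.Nullary.Decidable using (map′; ¬?; _×-dec_; _⊎-dec_; _→-dec_)
open import Relation.Unary using (Pred; Decidable)

private
  variable
    n : ℕ

record Graph (n : ℕ) : Set₁ where
  infix 4 _~_ _~?_
  field
    _~_    : Rel (Fin n) 0ℓ
    _~?_   : B.Decidable _~_
    ~-sym  : B.Symmetric _~_
    ~-irr  : ∀ v → ¬ (v ~ v)

comprehension : {P : Pred (Fin n) 0ℓ} → Decidable P → Subset n
comprehension P? = tabulate (does ∘ P?)

neighbourhood : Graph n → Fin n → Subset n
neighbourhood G v = comprehension (λ u → v ~? u)
  where open Graph G

degree : Graph n → Fin n → ℕ
degree G v = ∣ neighbourhood G v ∣

leaves : Graph n → Subset n
leaves G = comprehension (λ v → degree G v ℕₚ.≟ 1)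

numLeaves : Graph n → ℕ
numLeaves G = ∣ leaves G ∣

Walk : Graph n → Rel (Fin n) 0ℓ
Walk G = Star (Graph._~_ G)

module _ {_~_ : Rel (Fin n) 0ℓ} where

  length : ∀ {u v} → Star _~_ u v → ℕ
  length ε       = 0
  length (_ ◅ w) = suc (length w)

  vertices : ∀ {u v} → Star _~_ u v → List (Fin n)
  vertices {u} ε       = u ∷ []
  vertices {u} (_ ◅ w) = u ∷ vertices w

module _ (G : Graph n) where

  open Graph G

  Connected : Set
  Connected = ∀ u v → Walk G u v

  -- A cycle is a path with at least three vertices whose ends are adjacent.
  Acyclic : Set
  Acyclic = ∀ {u v} (w : Walk G u v) → Unique (vertices w) → 2 ≤ length w → ¬ (v ~ u)

  -- d(u , v) = k; no k satisfies this if u and v lie in different components.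
  Distance : Fin n → Fin n → ℕ → Set
  Distance u v k = (Σ[ w ∈ Walk G u v ] length w ≡ k)
                 × (∀ (w : Walk G u v) → k ≤ length w)

  IsDisjunctiveDominating : Pred (Subset n) 0ℓ
  IsDisjunctiveDominating D = ∀ v → v ∉ D →
      (∃[ u ] v ~ u × u ∈ D)
    ⊎ (∃₂ λ x y → x ≢ y × (x ∈ D × Distance v x 2) × (y ∈ D × Distance v y 2))

-- Nonemptiness is not demanded here: the order is bounded below separately.
record IsTree (G : Graph n) : Set where
  field
    connected : Connected G
    acyclic   : Acyclic G

IsMinimum : Pred ℕ 0ℓ → Pred ℕ 0ℓ
IsMinimum P k = P k × (∀ j → P j → k ≤ j)

minimum : {P : Pred ℕ 0ℓ} → Decidable P → ∃ P → ∃ (IsMinimum P)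
minimum {P} P? (m , pm) = go P? m pm
  where
  go : {Q : Pred ℕ 0ℓ} → Decidable Q → ∀ m → Q m → ∃ (IsMinimum Q)
  go Q? zero    q₀ = 0 , q₀ , λ _ _ → z≤n
  go Q? (suc m) qₘ with Q? 0
  ... | yes q₀ = 0 , q₀ , λ _ _ → z≤n
  ... | no ¬q₀ with go (Q? ∘ suc) m qₘ
  ...   | k , qₖ , least = suc k , qₖ , λ where
    zero    q₀ → ⊥-elim (¬q₀ q₀)
    (suc j) qⱼ → s≤s (least j qⱼ)

module _ (G : Graph n) where

  open Graph G

  walkOfLength? : ∀ u v k → Dec (Σ[ w ∈ Walk G u v ] length w ≡ k)
  walkOfLength? u v zero =
    map′ (λ { refl → ε , refl }) (λ { (ε , _) → refl }) (u ≟ v)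
  walkOfLength? u v (suc k) =
    map′ (λ { (_ , a , w , eq) → a ◅ w , cong suc eq })
         (λ { (a ◅ w , refl) → _ , a , w , refl })
         (any? λ x → (u ~? x) ×-dec walkOfLength? x v k)

  distance? : ∀ u v k → Dec (Distance G u v k)
  distance? u v k = walkOfLength? u v k ×-dec
    map′ (λ none w → ≮⇒≥ λ w<k → none w<k (w , refl))
         (λ { least j<k (w , refl) → <⇒≱ j<k (least w) })
         (allUpTo? (λ j → ¬? (walkOfLength? u v j)) k)

  isDisjunctiveDominating? : Decidable (IsDisjunctiveDominating G)
  isDisjunctiveDominating? D = all? λ v → ¬? (v ∈? D) →-dec
    ( any? (λ u → (v ~? u) ×-dec (u ∈? D))
    ⊎-dec any? λ x → any? λ y → ¬? (x ≟ y)
            ×-dec ((x ∈? D) ×-dec distance? v x 2)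
            ×-dec ((y ∈? D) ×-dec distance? v y 2))

  SizeOfDisjunctiveDominatingSet : Pred ℕ 0ℓ
  SizeOfDisjunctiveDominatingSet k = ∃[ D ] IsDisjunctiveDominating G D × ∣ D ∣ ≡ k

  disjunctiveDomination : ∃ (IsMinimum SizeOfDisjunctiveDominatingSet)
  disjunctiveDomination = minimum
    (λ k → anySubset? λ D → isDisjunctiveDominating? D ×-dec (∣ D ∣ ℕₚ.≟ k))
    (_ , ⊤ , (λ _ v∉⊤ → ⊥-elim (v∉⊤ ∈⊤)) , refl)

  γᵈ₂ : ℕ
  γᵈ₂ = proj₁ disjunctiveDomination

  γᵈ₂-isMinimum : IsMinimum SizeOfDisjunctiveDominatingSet γᵈ₂
  γᵈ₂-isMinimum = proj₂ disjunctiveDomination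

pathGraph : ∀ n → Graph n
pathGraph n = record
  { _~_   = λ i j → Next i j ⊎ Next j i
  ; _~?_  = λ i j → next? i j ⊎-dec next? j i
  ; ~-sym = swap
  ; ~-irr = λ { v (inj₁ e) → ℕₚ.1+n≢n e ; v (inj₂ e) → ℕₚ.1+n≢n e }
  }
  where
  Next : Rel (Fin n) 0ℓ
  Next i j = suc (toℕ i) ≡ toℕ j

  next? : B.Decidable Next
  next? i j = suc (toℕ i) ℕₚ.≟ toℕ j

-- Adds a new vertex, zero, and an edge from it to v; an old vertex u becomes suc u.
addPendant : Graph n → Fin n → Graph (suc n)
addPendant {n} G v = record
  { _~_   = Adj
  ; _~?_  = dec
  ; ~-sym = λ {x} {y} → symm x y
  ; ~-irr = irr
  }
  where
  open Graph G

  Adj : Rel (Fin (suc n)) 0ℓ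
  Adj zero    zero    = ⊥
  Adj zero    (suc y) = y ≡ v
  Adj (suc x) zero    = x ≡ v
  Adj (suc x) (suc y) = x ~ y

  dec : B.Decidable Adj
  dec zero    zero    = no λ ()
  dec zero    (suc y) = y ≟ v
  dec (suc x) zero    = x ≟ v
  dec (suc x) (suc y) = x ~? y

  symm : ∀ x y → Adj x y → Adj y x
  symm zero    (suc y) e = e
  symm (suc x) zero    e = e
  symm (suc x) (suc y) e = ~-sym e

  irr : ∀ x → ¬ Adj x x
  irr (suc x) e = ~-irr x e

data Status : Set where
  A B C D : Status

-- A partition of the vertex set into four possibly empty parts, as its status function.
Labeling : ℕ → Set
Labeling n = Fin n → Status

record LabeledGraph (n : ℕ) : Set₁ where
  constructor ⟨_,_⟩
  field
    graph : Graph n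
    sta   : Labeling n

infixr 5 _∷ᴸ_
infixl 5 _+[_∷_]

_∷ᴸ_ : Status → Labeling n → Labeling (suc n)
(s ∷ᴸ S) zero    = s
(s ∷ᴸ S) (suc u) = S u

_+[_∷_] : LabeledGraph n → Status → Fin n → LabeledGraph (suc n)
⟨ G , S ⟩ +[ s ∷ v ] = ⟨ addPendant G v , s ∷ᴸ S ⟩

𝒪₁ : LabeledGraph n → Fin n → LabeledGraph (suc n)
𝒪₁ L v = L +[ C ∷ v ]

-- The path u₁ u₂ u₃ u₄ hanging from v is built one vertex at a time: each uᵢ is
-- vertex zero at the moment uᵢ₊₁ is joined to it.
𝒪₃ : LabeledGraph n → Fin n → LabeledGraph (suc (suc (suc (suc n))))
𝒪₃ L v = L +[ D ∷ v ] +[ B ∷ zero ] +[ A ∷ zero ] +[ C ∷ zero ]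

P₃ : LabeledGraph 3
P₃ = ⟨ pathGraph 3 , S′ ⟩
  where
  S′ : Labeling 3
  S′ 0F = C
  S′ 1F = A
  S′ 2F = C

record _≅_ (L M : LabeledGraph n) : Set where
  open LabeledGraph
  field
    π        : Permutation′ n
    preserve : ∀ u v → Graph._~_ (graph L) u v
                     ⇔ Graph._~_ (graph M) (π ⟨$⟩ʳ u) (π ⟨$⟩ʳ v)
    sta-≡    : ∀ v → sta M (π ⟨$⟩ʳ v) ≡ sta L v

-- Labeled trees are considered up to isomorphism, which on the concrete vertex
-- sets Fin n must be made explicit by the last constructor.
data 𝒯₁ : ∀ {n} → LabeledGraph n → Set₁ where
  base  : 𝒯₁ P₃
  step₁ : ∀ {n} {L : LabeledGraph n} (v : Fin n) →
          LabeledGraph.sta L v ≡ A → 𝒯₁ L → 𝒯₁ (𝒪₁ L v)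
  step₃ : ∀ {n} {L : LabeledGraph n} (v : Fin n) →
          LabeledGraph.sta L v ≡ C → degree (LabeledGraph.graph L) v ≡ 1 →
          𝒯₁ L → 𝒯₁ (𝒪₃ L v)
  iso   : ∀ {n} {L M : LabeledGraph n} → L ≅ M → 𝒯₁ L → 𝒯₁ M

{-# OPTIONS --safe #-}

-- Lower bound by discharging. Let D be a disjunctive dominating set. Since a
-- tree has n - 1 edges, n - l + 3 ≤ 4|D| says that charges of 3 on every edge and
-- 1 on every leaf suffice to give 4 to every vertex outside D. A neighbour of D
-- takes 3 from its edge to D; a vertex at distance 2 from D takes 2 from the edge
-- to each of two neighbours of D, or 3 if they coincide, as that neighbour then
-- has two edges to D. Whoever is left with 3 is a leaf or takes 1 from another edge.
--
-- If the bound is attained, nothing is wasted: vertices of D and vertices far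
-- from D are adjacent only to vertices with exactly one neighbour in D, each of
-- which has at most one other neighbour, and far vertices have degree 2. Such a
-- tree is regrown from a path with centre in D: by acyclicity a vertex outside a
-- subtree has at most one neighbour in it, so what is attached on an edge leaving
-- the subtree is exactly a leaf at a vertex of D or a path at a leaf.
--
-- Conversely, in a tree of the family the vertices of status A dominate, and both
-- operations preserve 4|A| + l ≤ n + 3.
module Submission where

open import Defs
open import Algebra.Bundles using (AbelianGroup)
open import Data.Bool.Base using (true; false; if_then_else_)
open import Data.Empty using (⊥-elim)
open import Data.Fin.Base using (Fin; zero; suc; fromℕ<)
open import Data.Fin.Patterns using (0F; 1F; 2F; 3F)
open import Data.Fin.Permutation
  using (Permutation; Permutation′; _⟨$⟩ʳ_; _⟨$⟩ˡ_; permutation; ↔⇒≡; inverseˡ; inverseʳ)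
  renaming (id to idₚ)
open import Data.Fin.Properties using (_≟_; any?; all?; ¬∀⟶∃¬; injective⇒≤; suc-injective; 0≢1+n)
open import Data.Fin.Subset using (Subset; _∈_; _∉_; ∣_∣; inside; outside)
open import Data.Fin.Subset.Properties using (_∈?_)
open import Data.Integer.Base as ℤ using ()
import Data.Integer.Properties as ℤₚ
import Data.Integer.Tactic.RingSolver as RSℤ
open import Data.List.Base as List using (_∷_)
import Data.List.Membership.DecPropositional as DecL
open import Data.List.Membership.Propositional as L using ()
open import Data.List.Relation.Unary.All as All using ([]; _∷_)
open import Data.List.Relation.Unary.All.Properties using (¬Any⇒All¬) renaming (map⁺ to mapᴬ⁺)
open import Data.List.Relation.Unary.AllPairs using ([]; _∷_)
open import Data.List.Relation.Unary.Any using (here; there)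
open import Data.List.Relation.Unary.Unique.Propositional using (Unique)
open import Data.List.Relation.Unary.Unique.Propositional.Properties using () renaming (map⁺ to mapᵁ⁺)
open import Data.Nat.Base as ℕ using (ℕ; zero; suc; _+_; _*_; _≤_; _<_; z≤n; s≤s)
open import Data.Nat.Properties as ℕₚ using (+-*-semiring)
import Data.Nat.Tactic.RingSolver as RS
open import Data.Product using (Σ-syntax; ∃; ∃-syntax; ∃₂; _×_; _,_; proj₁; proj₂)
open import Data.Rational.Base using (_/_; _≥_)
import Data.Rational.Properties as ℚₚ
open import Data.Rational.Unnormalised.Base using (ℚᵘ; mkℚᵘ; *≤*; *≡*)
import Data.Rational.Unnormalised.Properties as ℚᵘₚ
open import Data.Sum using (_⊎_; inj₁; inj₂)
import Data.Vec.Base as Vec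
import Data.Vec.Functional as F
open import Data.Vec.Functional.Properties using (updateAt-minimal; updateAt-updates)
open import Data.Vec.Properties using (lookup∘tabulate; lookup⇒[]=)
open import Function.Base using (_∘_; id; case_of_)
open import Function.Bundles using (_⇔_; mk⇔; Equivalence)
open import Relation.Binary.Construct.Closure.ReflexiveTransitive using (ε; _◅_; _◅◅_; gmap)
open import Relation.Binary.PropositionalEquality
  using (_≡_; _≢_; refl; sym; trans; cong; cong₂; subst; subst₂; module ≡-Reasoning)
open import Relation.Nullary using (Dec; yes; no; does; ¬_)
open import Relation.Nullary.Decidable using (dec-true; dec-false; ¬?; _×-dec_; decidable-stable)
open import Relation.Unary using (Pred; Decidable)

open import Algebra.Properties.Semiring.Sum +-*-semiring
  using (sum; ∑-distrib-+; ∑-comm; ∑-permute; sum-cong-≗; *-distribˡ-sum)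

private
  variable
    m n : ℕ

-- Finite sums

𝟙 : {P : Set} → Dec P → ℕ
𝟙 P? = if does P? then 1 else 0

𝟙-yes : {P : Set} (P? : Dec P) → P → 𝟙 P? ≡ 1
𝟙-yes P? p = cong (if_then 1 else 0) (dec-true P? p)

𝟙-no : {P : Set} (P? : Dec P) → ¬ P → 𝟙 P? ≡ 0
𝟙-no P? ¬p = cong (if_then 1 else 0) (dec-false P? ¬p)

𝟙-cong : {P Q : Set} (P? : Dec P) (Q? : Dec Q) → (P → Q) → (Q → P) → 𝟙 P? ≡ 𝟙 Q?
𝟙-cong (yes p) Q? to from = sym (𝟙-yes Q? (to p))
𝟙-cong (no ¬p) Q? to from = sym (𝟙-no Q? (¬p ∘ from))

sum-mono : {f g : Fin n → ℕ} → (∀ i → f i ≤ g i) → sum f ≤ sum g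
sum-mono {zero}  f≤g = z≤n
sum-mono {suc n} f≤g = ℕₚ.+-mono-≤ (f≤g 0F) (sum-mono (f≤g ∘ suc))

-- A deficit at one index could not be made up elsewhere. This is how equality in the total turns
-- into equality at every vertex and on every edge.
sum-tight : {f g : Fin n → ℕ} → (∀ i → f i ≤ g i) → sum g ≤ sum f → ∀ i → g i ≤ f i
sum-tight {suc n} {f} {g} f≤g ∑g≤∑f 0F =
  ℕₚ.+-cancelʳ-≤ (sum (g ∘ suc)) _ _
    (ℕₚ.≤-trans ∑g≤∑f (ℕₚ.+-monoʳ-≤ (f 0F) (sum-mono (f≤g ∘ suc))))
sum-tight {suc n} {f} {g} f≤g ∑g≤∑f (suc i) =
  sum-tight (f≤g ∘ suc)
    (ℕₚ.+-cancelˡ-≤ (g 0F) _ _ (ℕₚ.≤-trans ∑g≤∑f (ℕₚ.+-monoˡ-≤ (sum (f ∘ suc)) (f≤g 0F)))) i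

sum-zero : {f : Fin n → ℕ} → (∀ i → f i ≡ 0) → sum f ≡ 0
sum-zero {zero}  f≡0 = refl
sum-zero {suc n} f≡0 = cong₂ _+_ (f≡0 0F) (sum-zero (f≡0 ∘ suc))

sum-ones : ∀ n → sum {n} (λ _ → 1) ≡ n
sum-ones zero    = refl
sum-ones (suc n) = cong suc (sum-ones n)

-- The entry is zeroed rather than deleted, so the index type stays `Fin n` and other indices keep
-- their names.
without : Fin n → (Fin n → ℕ) → Fin n → ℕ
without i f = F.updateAt f i (λ _ → 0)

without-≢ : ∀ {i j : Fin n} (f : Fin n → ℕ) → j ≢ i → without i f j ≡ f j
without-≢ f j≢i = updateAt-minimal _ _ f j≢i

sum-without : (f : Fin n → ℕ) (i : Fin n) → sum f ≡ f i + sum (without i f)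
sum-without {suc n} f 0F      = refl
sum-without {suc n} f (suc i) = begin
  f 0F + sum (f ∘ suc)                                  ≡⟨ cong (f 0F +_) (sum-without (f ∘ suc) i) ⟩
  f 0F + (f (suc i) + sum (without i (f ∘ suc)))        ≡⟨ x∙yz≈y∙xz (f 0F) (f (suc i)) _ ⟩
  f (suc i) + sum (without (suc i) f)                   ∎
  where
  open ≡-Reasoning
  open import Algebra.Properties.CommutativeSemigroup ℕₚ.+-commutativeSemigroup using (x∙yz≈y∙xz)

term≤sum : (f : Fin n → ℕ) (i : Fin n) → f i ≤ sum f
term≤sum f i = ℕₚ.≤-trans (ℕₚ.m≤m+n _ _) (ℕₚ.≤-reflexive (sym (sum-without f i)))

two≤sum : (f : Fin n → ℕ) {i j : Fin n} → j ≢ i → f i + f j ≤ sum f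
two≤sum f {i} {j} j≢i = begin
  f i + f j                 ≡⟨ cong (f i +_) (without-≢ f j≢i) ⟨
  f i + without i f j       ≤⟨ ℕₚ.+-monoʳ-≤ (f i) (term≤sum (without i f) j) ⟩
  f i + sum (without i f)   ≡⟨ sum-without f i ⟨
  sum f                     ∎
  where open ℕₚ.≤-Reasoning

three≤sum : (f : Fin n → ℕ) {i j k : Fin n} → j ≢ i → k ≢ i → k ≢ j → f i + (f j + f k) ≤ sum f
three≤sum f {i} {j} {k} j≢i k≢i k≢j = begin
  f i + (f j + f k)                         ≡⟨ cong₂ (λ x y → f i + (x + y)) (without-≢ f j≢i) (without-≢ f k≢i) ⟨
  f i + (without i f j + without i f k)     ≤⟨ ℕₚ.+-monoʳ-≤ (f i) (two≤sum (without i f) k≢j) ⟩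
  f i + sum (without i f)                   ≡⟨ sum-without f i ⟨
  sum f                                     ∎
  where open ℕₚ.≤-Reasoning

sum-𝟙-unique : {P : Pred (Fin n) _} (P? : Decidable P) {i : Fin n} → P i → (∀ {j} → P j → j ≡ i) →
               sum (λ j → 𝟙 (P? j)) ≡ 1
sum-𝟙-unique {P = P} P? {i} p unique = begin
  sum f                     ≡⟨ sum-without f i ⟩
  f i + sum (without i f)   ≡⟨ cong₂ _+_ (𝟙-yes (P? i) p) (sum-zero vanish) ⟩
  1                         ∎
  where
  open ≡-Reasoning
  f : Fin _ → ℕ
  f j = 𝟙 (P? j)
  vanish : ∀ j → without i f j ≡ 0
  vanish j with j ≟ i
  ... | yes refl = updateAt-updates i f
  ... | no j≢i   = trans (without-≢ f j≢i) (𝟙-no (P? j) (j≢i ∘ unique))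

∣comprehension∣ : {P : Pred (Fin n) _} (P? : Decidable P) →
                  ∣ comprehension P? ∣ ≡ sum (λ i → 𝟙 (P? i))
∣comprehension∣ {zero}  P? = refl
∣comprehension∣ {suc n} P? with does (P? 0F)
... | true  = cong suc (∣comprehension∣ (P? ∘ suc))
... | false = ∣comprehension∣ (P? ∘ suc)

∣subset∣ : (p : Subset n) → ∣ p ∣ ≡ sum (λ v → 𝟙 (v ∈? p))
∣subset∣ Vec.[]            = refl
∣subset∣ (inside  Vec.∷ p) = cong suc (∣subset∣ p)
∣subset∣ (outside Vec.∷ p) = ∣subset∣ p

∈-comprehension⁺ : {P : Pred (Fin n) _} (P? : Decidable P) {i : Fin n} → P i → i ∈ comprehension P?
∈-comprehension⁺ P? {i} p =
  lookup⇒[]= i _ (trans (lookup∘tabulate (does ∘ P?) i) (dec-true (P? i) p))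

-- Degrees

module _ (G : Graph n) where
  open Graph G

  degree≡sum : ∀ v → degree G v ≡ sum (λ u → 𝟙 (v ~? u))
  degree≡sum v = ∣comprehension∣ (v ~?_)

  degree≡1 : ∀ {v x} → v ~ x → (∀ {u} → v ~ u → u ≡ x) → degree G v ≡ 1
  degree≡1 {v} v~x unique = trans (degree≡sum v) (sum-𝟙-unique (v ~?_) v~x unique)

  another-neighbour : ∀ {v x} → v ~ x → degree G v ≢ 1 → ∃[ u ] u ≢ x × v ~ u
  another-neighbour {v} {x} v~x deg≢1 with any? (λ u → ¬? (u ≟ x) ×-dec (v ~? u))
  ... | yes found = found
  ... | no  none  = ⊥-elim (deg≢1 (degree≡1 v~x λ {u} v~u →
                      decidable-stable (u ≟ x) λ u≢x → none (u , u≢x , v~u)))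

  degree≥1 : ∀ {v x} → v ~ x → 1 ≤ degree G v
  degree≥1 {v} {x} v~x = begin
    1                          ≡⟨ 𝟙-yes (v ~? x) v~x ⟨
    𝟙 (v ~? x)                 ≤⟨ term≤sum (λ u → 𝟙 (v ~? u)) x ⟩
    sum (λ u → 𝟙 (v ~? u))     ≡⟨ degree≡sum v ⟨
    degree G v                 ∎
    where open ℕₚ.≤-Reasoning

  numLeaves≡sum : numLeaves G ≡ sum (λ v → 𝟙 (degree G v ℕₚ.≟ 1))
  numLeaves≡sum = ∣comprehension∣ (λ v → degree G v ℕₚ.≟ 1)

-- Discharging

-- The type of a vertex relative to a dominating set, by the number of its
-- neighbours in the set: the vertex is itself in the set, or has one, several
-- or no neighbours there.
data Class : Set where
  chosen single multi far : Class

-- The charge, out of a total of at most 3 on each edge, that a vertex of the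
-- first class passes to a neighbour of the second class.
pay : Class → Class → ℕ
pay chosen single = 3
pay chosen multi  = 3
pay single single = 1
pay multi  single = 1
pay far    single = 1
pay single far    = 2
pay multi  far    = 3
pay far    far    = 1
pay _      _      = 0

-- The full 3 is spent only between `chosen` or `far` on one side and `single` or `multi` on the
-- other. All other pairs are strict, which rules them out as edges once the bound is attained.
pay-budget : ∀ a b → pay a b + pay b a ≤ 3
pay-budget chosen chosen = z≤n
pay-budget chosen single = ℕₚ.≤-refl
pay-budget chosen multi  = ℕₚ.≤-refl
pay-budget chosen far    = z≤n
pay-budget single chosen = ℕₚ.≤-refl
pay-budget single single = s≤s (s≤s z≤n)
pay-budget single multi  = s≤s z≤n
pay-budget single far    = ℕₚ.≤-refl
pay-budget multi  chosen = ℕₚ.≤-refl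
pay-budget multi  single = s≤s z≤n
pay-budget multi  multi  = z≤n
pay-budget multi  far    = ℕₚ.≤-refl
pay-budget far    chosen = z≤n
pay-budget far    single = ℕₚ.≤-refl
pay-budget far    multi  = ℕₚ.≤-refl
pay-budget far    far    = s≤s (s≤s z≤n)

-- The shape forced on the tree when the bound is attained: the far vertices
-- are the midpoints of paths joining members of the dominating set.
record Extremal (G : Graph n) (cls : Fin n → Class) : Set where
  open Graph G
  field
    no-multi       : ∀ v → cls v ≢ multi
    chosen-nbr     : ∀ {v u} → cls v ≡ chosen → v ~ u → cls u ≡ single
    chosen-two     : ∀ {v} → cls v ≡ chosen → ∃₂ λ a b → a ≢ b × v ~ a × v ~ b
    single-nbr     : ∀ {v u} → cls v ≡ single → v ~ u → cls u ≡ chosen ⊎ cls u ≡ far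
    single-chosen  : ∀ {v} → cls v ≡ single → ∃[ x ] v ~ x × cls x ≡ chosen
    single-chosen! : ∀ {v x y} → cls v ≡ single → v ~ x → v ~ y →
                     cls x ≡ chosen → cls y ≡ chosen → x ≡ y
    single-far!    : ∀ {v x y} → cls v ≡ single → v ~ x → v ~ y →
                     cls x ≡ far → cls y ≡ far → x ≡ y
    far-nbr        : ∀ {v u} → cls v ≡ far → v ~ u → cls u ≡ single
    far-another    : ∀ {v x} → cls v ≡ far → v ~ x → ∃[ u ] u ≢ x × v ~ u
    far-only       : ∀ {v a b u} → cls v ≡ far → v ~ a → v ~ b → b ≢ a → v ~ u → u ≡ a ⊎ u ≡ b

distance-2-midpoint : (G : Graph n) {v x : Fin n} → Distance G v x 2 →
                      ∃[ a ] Graph._~_ G v a × Graph._~_ G a x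
distance-2-midpoint G ((e ◅ e′ ◅ ε , refl) , _) = _ , e , e′

module Discharging (G : Graph n) (D : Subset n) (dominating : IsDisjunctiveDominating G D)
                   (neighbour : ∀ v → ∃[ u ] Graph._~_ G v u) where
  open Graph G

  HasClass : Fin n → Class → Set
  HasClass v chosen = v ∈ D
  HasClass v single = v ∉ D × ∃[ x ] (v ~ x × x ∈ D) × (∀ {y} → v ~ y → y ∈ D → y ≡ x)
  HasClass v multi  = v ∉ D × ∃₂ λ x y → y ≢ x × (v ~ x × x ∈ D) × (v ~ y × y ∈ D)
  HasClass v far    = v ∉ D × (∀ {y} → v ~ y → y ∉ D)

  classify : ∀ v → ∃ (HasClass v)
  classify v with v ∈? D
  ... | yes v∈D = chosen , v∈D
  ... | no  v∉D with any? (λ x → (v ~? x) ×-dec (x ∈? D))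
  ...   | no  none = far , v∉D , λ v~y y∈D → none (_ , v~y , y∈D)
  ...   | yes (x , v~x , x∈D) with any? (λ y → ¬? (y ≟ x) ×-dec ((v ~? y) ×-dec (y ∈? D)))
  ...     | yes (y , y≢x , v~y , y∈D) = multi , v∉D , x , y , y≢x , (v~x , x∈D) , (v~y , y∈D)
  ...     | no  none = single , v∉D , x , (v~x , x∈D) , λ {y} v~y y∈D →
              decidable-stable (y ≟ x) λ y≢x → none (y , y≢x , v~y , y∈D)

  cls : Fin n → Class
  cls v = proj₁ (classify v)

  hasClass : ∀ v → HasClass v (cls v)
  hasClass v = proj₂ (classify v)

  asClass : ∀ {v c} → cls v ≡ c → HasClass v c
  asClass {v} refl = hasClass v

  chosen-if : ∀ {v} → v ∈ D → cls v ≡ chosen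
  -- The class is passed as a variable together with its evidence, so that splitting on it refines
  -- the evidence too.
  chosen-if {v} v∈D = go (cls v) (hasClass v)
    where
    go : ∀ c → HasClass v c → c ≡ chosen
    go chosen _         = refl
    go single (v∉D , _) = ⊥-elim (v∉D v∈D)
    go multi  (v∉D , _) = ⊥-elim (v∉D v∈D)
    go far    (v∉D , _) = ⊥-elim (v∉D v∈D)

  multi-if : ∀ {v x y} → v ∉ D → y ≢ x → v ~ x → x ∈ D → v ~ y → y ∈ D → cls v ≡ multi
  multi-if {v} v∉D y≢x v~x x∈D v~y y∈D = go (cls v) (hasClass v)
    where
    go : ∀ c → HasClass v c → c ≡ multi
    go chosen v∈D                = ⊥-elim (v∉D v∈D)
    go single (_ , _ , _ , only) = ⊥-elim (y≢x (trans (only v~y y∈D) (sym (only v~x x∈D))))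
    go multi  _                  = refl
    go far    (_ , none)         = ⊥-elim (none v~x x∈D)

  -- The indicator extends the payment by zero to all ordered pairs, so that row and column sums can
  -- be exchanged.
  flow : Fin n → Fin n → ℕ
  flow u v = 𝟙 (u ~? v) * pay (cls u) (cls v)

  receipt : Fin n → ℕ
  receipt v = sum (λ u → flow u v)

  leaf : Fin n → ℕ
  leaf v = 𝟙 (degree G v ℕₚ.≟ 1)

  -- Vertices of `D` are credited with 4 outright; this is the source of the term 4|D|.
  member : Fin n → ℕ
  member v = 4 * 𝟙 (v ∈? D)

  pay≤flow : ∀ {u v c d} → v ~ u → cls u ≡ c → cls v ≡ d → pay c d ≤ flow u v
  pay≤flow {u} {v} v~u refl refl = ℕₚ.≤-reflexive (begin
    pay (cls u) (cls v)                 ≡⟨ ℕₚ.*-identityˡ _ ⟨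
    1 * pay (cls u) (cls v)             ≡⟨ cong (_* pay (cls u) (cls v)) (𝟙-yes (u ~? v) (~-sym v~u)) ⟨
    flow u v                            ∎)
    where open ≡-Reasoning

  pay-near : ∀ {a x} → a ∉ D → a ~ x → x ∈ D → 2 ≤ pay (cls a) far
  pay-near {a} a∉D a~x x∈D = go (cls a) (hasClass a)
    where
    go : ∀ c → HasClass a c → 2 ≤ pay c far
    go chosen a∈D        = ⊥-elim (a∉D a∈D)
    go single _          = ℕₚ.≤-refl
    go multi  _          = s≤s (s≤s z≤n)
    go far    (_ , none) = ⊥-elim (none a~x x∈D)

  pay-far : ∀ {a} → a ∉ D → 1 ≤ pay (cls a) far
  pay-far {a} a∉D = go (cls a) (hasClass a)
    where
    go : ∀ c → HasClass a c → 1 ≤ pay c far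
    go chosen a∈D = ⊥-elim (a∉D a∈D)
    go single _   = s≤s z≤n
    go multi  _   = s≤s z≤n
    go far    _   = s≤s z≤n

  pay-single : ∀ c → 1 ≤ pay c single
  pay-single chosen = s≤s z≤n
  pay-single single = s≤s z≤n
  pay-single multi  = s≤s z≤n
  pay-single far    = s≤s z≤n

  -- The missing 1 is the charge of `v` itself if `v` is a leaf, and otherwise comes from a second
  -- neighbour.
  three+leaf : ∀ {v x} → v ~ x → 3 ≤ flow x v → (∀ {u} → u ≢ x → v ~ u → 1 ≤ flow u v) →
               4 ≤ receipt v + leaf v
  three+leaf {v} {x} v~x 3≤ 1≤ with degree G v ℕₚ.≟ 1
  ... | yes deg≡1 = ℕₚ.+-mono-≤ (ℕₚ.≤-trans 3≤ (term≤sum (λ u → flow u v) x))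
                                 (ℕₚ.≤-reflexive (sym (𝟙-yes (degree G v ℕₚ.≟ 1) deg≡1)))
  ... | no  deg≢1 with another-neighbour G v~x deg≢1
  ...   | u , u≢x , v~u = ℕₚ.≤-trans
    (ℕₚ.≤-trans (ℕₚ.+-mono-≤ 3≤ (1≤ u≢x v~u)) (two≤sum (λ u → flow u v) u≢x))
    (ℕₚ.m≤m+n _ _)

  single-enough : ∀ {v} → cls v ≡ single → 4 ≤ receipt v + leaf v
  single-enough {v} eq = case asClass eq of λ where
    (_ , x , (v~x , x∈D) , _) → three+leaf v~x (pay≤flow v~x (chosen-if x∈D) eq)
      λ {u} _ v~u → ℕₚ.≤-trans (pay-single (cls u)) (pay≤flow v~u refl eq)

  -- Two neighbours in `D` pass 3 each. The surplus over 4 is what excludes `multi` when the bound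
  -- is attained.
  multi-enough : ∀ {v} → cls v ≡ multi → 6 ≤ receipt v
  multi-enough {v} eq = case asClass eq of λ where
    (_ , x , y , y≢x , (v~x , x∈D) , (v~y , y∈D)) → ℕₚ.≤-trans
      (ℕₚ.+-mono-≤ (pay≤flow v~x (chosen-if x∈D) eq) (pay≤flow v~y (chosen-if y∈D) eq))
      (two≤sum (λ u → flow u v) y≢x)

  -- Two vertices of `D` at distance 2 are reached through two midpoints. If these differ, each is
  -- outside `D` with a neighbour in `D`; if they coincide, the midpoint has two neighbours in `D`.
  far-view : ∀ {v} → cls v ≡ far →
             (∃₂ λ a b → b ≢ a × (v ~ a × 2 ≤ pay (cls a) far) × (v ~ b × 2 ≤ pay (cls b) far))
           ⊎ (∃[ a ] v ~ a × cls a ≡ multi)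
  far-view {v} eq with asClass eq
  ... | v∉D , none with dominating v v∉D
  ...   | inj₁ (u , v~u , u∈D) = ⊥-elim (none v~u u∈D)
  ...   | inj₂ (x , y , x≢y , (x∈D , dist-x) , (y∈D , dist-y))
    with distance-2-midpoint G dist-x | distance-2-midpoint G dist-y
  ...     | a , v~a , a~x | b , v~b , b~y with b ≟ a
  ...       | yes refl = inj₂ (a , v~a , multi-if (none v~a) (x≢y ∘ sym) a~x x∈D b~y y∈D)
  ...       | no  b≢a  = inj₁ (a , b , b≢a ,
                (v~a , pay-near (none v~a) a~x x∈D) , (v~b , pay-near (none v~b) b~y y∈D))

  far-enough : ∀ {v} → cls v ≡ far → 4 ≤ receipt v + leaf v
  far-enough {v} eq with far-view eq
  ... | inj₁ (a , b , b≢a , (v~a , 2≤a) , (v~b , 2≤b)) = begin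
    4                                               ≤⟨ ℕₚ.+-mono-≤ 2≤a 2≤b ⟩
    pay (cls a) far + pay (cls b) far               ≤⟨ ℕₚ.+-mono-≤ (pay≤flow v~a refl eq) (pay≤flow v~b refl eq) ⟩
    flow a v + flow b v                             ≤⟨ two≤sum (λ u → flow u v) b≢a ⟩
    receipt v                                       ≤⟨ ℕₚ.m≤m+n _ _ ⟩
    receipt v + leaf v                              ∎
    where open ℕₚ.≤-Reasoning
  ... | inj₂ (a , v~a , a-multi) = three+leaf v~a (pay≤flow v~a a-multi eq)
    λ {u} _ v~u → ℕₚ.≤-trans (pay-far (proj₂ (asClass eq) v~u)) (pay≤flow v~u refl eq)

  enough : ∀ v → 4 ≤ receipt v + leaf v + member v
  enough v = go (cls v) refl
    where
    4+ : 4 ≤ receipt v + leaf v → 4 ≤ receipt v + leaf v + member v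
    4+ 4≤ = ℕₚ.≤-trans 4≤ (ℕₚ.m≤m+n _ _)
    go : ∀ c → cls v ≡ c → 4 ≤ receipt v + leaf v + member v
    go chosen eq = ℕₚ.≤-trans (ℕₚ.≤-reflexive (sym (cong (4 *_) (𝟙-yes (v ∈? D) (asClass eq)))))
                              (ℕₚ.m≤n+m (member v) (receipt v + leaf v))
    go single eq = 4+ (single-enough eq)
    go multi  eq = 4+ (ℕₚ.≤-trans (ℕₚ.≤-trans (ℕₚ.m≤m+n 4 2) (multi-enough eq)) (ℕₚ.m≤m+n _ _))
    go far    eq = 4+ (far-enough eq)

  edge-budget : ∀ u v → flow u v + flow v u ≤ 3 * 𝟙 (u ~? v)
  edge-budget u v with u ~? v | v ~? u
  ... | yes _   | yes _   = ℕₚ.≤-trans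
    (ℕₚ.≤-reflexive (cong₂ _+_ (ℕₚ.*-identityˡ (pay (cls u) (cls v))) (ℕₚ.*-identityˡ (pay (cls v) (cls u)))))
    (pay-budget (cls u) (cls v))
  ... | yes u~v | no  v≁u = ⊥-elim (v≁u (~-sym u~v))
  ... | no  u≁v | yes v~u = ⊥-elim (u≁v (~-sym v~u))
  ... | no  _   | no  _   = z≤n

  row-budget : ∀ u → sum (λ v → flow u v + flow v u) ≤ 3 * degree G u
  row-budget u = begin
    sum (λ v → flow u v + flow v u)   ≤⟨ sum-mono (edge-budget u) ⟩
    sum (λ v → 3 * 𝟙 (u ~? v))        ≡⟨ *-distribˡ-sum 3 (λ v → 𝟙 (u ~? v)) ⟨
    3 * sum (λ v → 𝟙 (u ~? v))        ≡⟨ cong (3 *_) (degree≡sum G u) ⟨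
    3 * degree G u                    ∎
    where open ℕₚ.≤-Reasoning

  ∑degree ∑receipt : ℕ
  ∑degree  = sum (degree G)
  ∑receipt = sum receipt

  -- Summing over ordered pairs meets every edge from both ends, hence the factor 2. The degree sum
  -- counts edges twice in the same way.
  ∑rows : sum (λ u → sum (λ v → flow u v + flow v u)) ≡ ∑receipt + ∑receipt
  ∑rows = begin
    sum (λ u → sum (λ v → flow u v + flow v u))                      ≡⟨ sum-cong-≗ (λ u → ∑-distrib-+ (flow u) (λ v → flow v u)) ⟩
    sum (λ u → sum (flow u) + receipt u)                             ≡⟨ ∑-distrib-+ (λ u → sum (flow u)) receipt ⟩
    sum (λ u → sum (flow u)) + ∑receipt                              ≡⟨ cong (_+ ∑receipt) (∑-comm flow) ⟩
    ∑receipt + ∑receipt                                              ∎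
    where open ≡-Reasoning

  ∑income : sum (λ v → receipt v + leaf v + member v) ≡ ∑receipt + numLeaves G + 4 * ∣ D ∣
  ∑income = begin
    sum (λ v → receipt v + leaf v + member v)          ≡⟨ ∑-distrib-+ (λ v → receipt v + leaf v) member ⟩
    sum (λ v → receipt v + leaf v) + sum member        ≡⟨ cong₂ _+_ (∑-distrib-+ receipt leaf) (sym (*-distribˡ-sum 4 (λ v → 𝟙 (v ∈? D)))) ⟩
    ∑receipt + sum leaf + 4 * sum (λ v → 𝟙 (v ∈? D))   ≡⟨ cong₂ (λ x y → ∑receipt + x + 4 * y) (numLeaves≡sum G) (∣subset∣ D) ⟨
    ∑receipt + numLeaves G + 4 * ∣ D ∣                 ∎
    where open ≡-Reasoning

  ∑enough : 4 * n ≤ ∑receipt + numLeaves G + 4 * ∣ D ∣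
  ∑enough = begin
    4 * n                                       ≡⟨ cong (4 *_) (sum-ones n) ⟨
    4 * sum {n} (λ _ → 1)                       ≡⟨ *-distribˡ-sum {n} 4 (λ _ → 1) ⟩
    sum {n} (λ _ → 4)                           ≤⟨ sum-mono enough ⟩
    sum (λ v → receipt v + leaf v + member v)   ≡⟨ ∑income ⟩
    ∑receipt + numLeaves G + 4 * ∣ D ∣          ∎
    where open ℕₚ.≤-Reasoning

  ∑budget : ∑receipt + ∑receipt ≤ 3 * ∑degree
  ∑budget = begin
    ∑receipt + ∑receipt                               ≡⟨ ∑rows ⟨
    sum (λ u → sum (λ v → flow u v + flow v u))       ≤⟨ sum-mono row-budget ⟩
    sum (λ u → 3 * degree G u)                        ≡⟨ *-distribˡ-sum 3 (degree G) ⟨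
    3 * ∑degree                                       ∎
    where open ℕₚ.≤-Reasoning

  -- The degree sum 2(n - 1) of a tree, stated without subtraction.
  module _ (handshake : ∑degree + 2 ≡ n + n) where

    order-bound : n + 3 ≤ 4 * ∣ D ∣ + numLeaves G
    -- The inequality is doubled because edges are counted twice, and 6n, which is 3 times the
    -- degree sum plus 2, is added to both sides to avoid subtraction.
    order-bound = ℕₚ.*-cancelˡ-≤ 2 (ℕₚ.+-cancelˡ-≤ (6 * n) _ _ (begin
      6 * n + 2 * (n + 3)                             ≡⟨ regroup₀ n ⟩
      2 * (4 * n) + 6                                 ≤⟨ ℕₚ.+-monoˡ-≤ 6 (ℕₚ.*-monoʳ-≤ 2 ∑enough) ⟩
      2 * (∑receipt + l + 4 * k) + 6                  ≡⟨ regroup ∑receipt l k ⟩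
      ∑receipt + ∑receipt + (6 + 2 * (4 * k + l))     ≤⟨ ℕₚ.+-monoˡ-≤ _ ∑budget ⟩
      3 * ∑degree + (6 + 2 * (4 * k + l))             ≡⟨ regroup′ ∑degree (4 * k + l) ⟩
      3 * (∑degree + 2) + 2 * (4 * k + l)             ≡⟨ cong (λ x → 3 * x + 2 * (4 * k + l)) handshake ⟩
      3 * (n + n) + 2 * (4 * k + l)                   ≡⟨ cong (_+ 2 * (4 * k + l)) (six n) ⟩
      6 * n + 2 * (4 * k + l)                         ∎))
      where
      open ℕₚ.≤-Reasoning
      k = ∣ D ∣
      l = numLeaves G
      regroup₀ : ∀ n → 6 * n + 2 * (n + 3) ≡ 2 * (4 * n) + 6
      regroup₀ = RS.solve-∀
      regroup : ∀ r l k → 2 * (r + l + 4 * k) + 6 ≡ r + r + (6 + 2 * (4 * k + l))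
      regroup = RS.solve-∀
      regroup′ : ∀ d x → 3 * d + (6 + 2 * x) ≡ 3 * (d + 2) + 2 * x
      regroup′ = RS.solve-∀
      six : ∀ n → 3 * (n + n) ≡ 6 * n
      six = RS.solve-∀

    -- Consequences of attaining the bound

    module _ (attained : 4 * ∣ D ∣ + numLeaves G ≤ n + 3) where

      -- Attainment reverses the outcome of `order-bound`, so both inequalities used there must be
      -- equalities; this is the converse of `∑enough`.
      ∑enough-tight : ∑receipt + numLeaves G + 4 * ∣ D ∣ ≤ 4 * n
      ∑enough-tight = ℕₚ.*-cancelˡ-≤ 2 (begin
        2 * (∑receipt + l + 4 * k)                  ≡⟨ regroup ∑receipt l k ⟩
        ∑receipt + ∑receipt + 2 * (4 * k + l)       ≤⟨ ℕₚ.+-mono-≤ ∑budget (ℕₚ.*-monoʳ-≤ 2 attained) ⟩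
        3 * ∑degree + 2 * (n + 3)                   ≡⟨ regroup′ ∑degree n ⟩
        3 * (∑degree + 2) + 2 * n                   ≡⟨ cong (λ x → 3 * x + 2 * n) handshake ⟩
        3 * (n + n) + 2 * n                         ≡⟨ eight n ⟩
        2 * (4 * n)                                 ∎)
        where
        open ℕₚ.≤-Reasoning
        k = ∣ D ∣
        l = numLeaves G
        regroup : ∀ r l k → 2 * (r + l + 4 * k) ≡ r + r + 2 * (4 * k + l)
        regroup = RS.solve-∀
        regroup′ : ∀ d n → 3 * d + 2 * (n + 3) ≡ 3 * (d + 2) + 2 * n
        regroup′ = RS.solve-∀
        eight : ∀ n → 3 * (n + n) + 2 * n ≡ 2 * (4 * n)
        eight = RS.solve-∀

      -- The converse of `∑budget`, for the same reason; the summand 6 + 2n lets `handshake` apply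
      -- without subtraction.
      ∑budget-tight : 3 * ∑degree ≤ ∑receipt + ∑receipt
      ∑budget-tight = ℕₚ.+-cancelʳ-≤ (6 + 2 * n) _ _ (begin
        3 * ∑degree + (6 + 2 * n)                   ≡⟨ regroup ∑degree n ⟩
        3 * (∑degree + 2) + 2 * n                   ≡⟨ cong (λ x → 3 * x + 2 * n) handshake ⟩
        3 * (n + n) + 2 * n                         ≡⟨ eight n ⟩
        2 * (4 * n)                                 ≤⟨ ℕₚ.*-monoʳ-≤ 2 ∑enough ⟩
        2 * (∑receipt + l + 4 * k)                  ≡⟨ regroup′ ∑receipt l k ⟩
        ∑receipt + ∑receipt + 2 * (4 * k + l)       ≤⟨ ℕₚ.+-monoʳ-≤ (∑receipt + ∑receipt) (ℕₚ.*-monoʳ-≤ 2 attained) ⟩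
        ∑receipt + ∑receipt + 2 * (n + 3)           ≡⟨ cong (λ x → ∑receipt + ∑receipt + x) (six n) ⟩
        ∑receipt + ∑receipt + (6 + 2 * n)           ∎)
        where
        open ℕₚ.≤-Reasoning
        k = ∣ D ∣
        l = numLeaves G
        regroup : ∀ d n → 3 * d + (6 + 2 * n) ≡ 3 * (d + 2) + 2 * n
        regroup = RS.solve-∀
        eight : ∀ n → 3 * (n + n) + 2 * n ≡ 2 * (4 * n)
        eight = RS.solve-∀
        regroup′ : ∀ r l k → 2 * (r + l + 4 * k) ≡ r + r + 2 * (4 * k + l)
        regroup′ = RS.solve-∀
        six : ∀ n → 2 * (n + 3) ≡ 6 + 2 * n
        six = RS.solve-∀

      income≤4 : ∀ v → receipt v + leaf v + member v ≤ 4
      income≤4 = sum-tight enough (begin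
        sum (λ v → receipt v + leaf v + member v)   ≡⟨ ∑income ⟩
        ∑receipt + numLeaves G + 4 * ∣ D ∣          ≤⟨ ∑enough-tight ⟩
        4 * n                                       ≡⟨ cong (4 *_) (sum-ones n) ⟨
        4 * sum {n} (λ _ → 1)                       ≡⟨ *-distribˡ-sum {n} 4 (λ _ → 1) ⟩
        sum {n} (λ _ → 4)                           ∎)
        where open ℕₚ.≤-Reasoning

      receipt≤4 : ∀ v → receipt v ≤ 4
      receipt≤4 v = ℕₚ.≤-trans (ℕₚ.m≤m+n _ _) (ℕₚ.≤-trans (ℕₚ.m≤m+n _ _) (income≤4 v))

      row-tight : ∀ u → 3 * degree G u ≤ sum (λ v → flow u v + flow v u)
      row-tight = sum-tight row-budget (begin
        sum (λ u → 3 * degree G u)                        ≡⟨ *-distribˡ-sum 3 (degree G) ⟨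
        3 * ∑degree                                       ≤⟨ ∑budget-tight ⟩
        ∑receipt + ∑receipt                               ≡⟨ ∑rows ⟨
        sum (λ u → sum (λ v → flow u v + flow v u))       ∎)
        where open ℕₚ.≤-Reasoning

      -- Tightness descends from the total to the rows and from each row to its entries, as every
      -- term respects its own budget.
      edge-tight : ∀ u v → 3 * 𝟙 (u ~? v) ≤ flow u v + flow v u
      edge-tight u = sum-tight (edge-budget u) (begin
        sum (λ v → 3 * 𝟙 (u ~? v))         ≡⟨ *-distribˡ-sum 3 (λ v → 𝟙 (u ~? v)) ⟨
        3 * sum (λ v → 𝟙 (u ~? v))         ≡⟨ cong (3 *_) (degree≡sum G u) ⟨
        3 * degree G u                     ≤⟨ row-tight u ⟩
        sum (λ v → flow u v + flow v u)    ∎)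
        where open ℕₚ.≤-Reasoning

      flow≤pay : ∀ u v → flow u v ≤ pay (cls u) (cls v)
      flow≤pay u v with u ~? v
      ... | yes _ = ℕₚ.≤-reflexive (ℕₚ.*-identityˡ (pay (cls u) (cls v)))
      ... | no  _ = z≤n

      pay-tight : ∀ {u v} → u ~ v → 3 ≤ pay (cls u) (cls v) + pay (cls v) (cls u)
      pay-tight {u} {v} u~v = begin
        3                                          ≡⟨ cong (3 *_) (𝟙-yes (u ~? v) u~v) ⟨
        3 * 𝟙 (u ~? v)                             ≤⟨ edge-tight u v ⟩
        flow u v + flow v u                        ≤⟨ ℕₚ.+-mono-≤ (flow≤pay u v) (flow≤pay v u) ⟩
        pay (cls u) (cls v) + pay (cls v) (cls u)  ∎
        where open ℕₚ.≤-Reasoning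

      no-multi : ∀ v → cls v ≢ multi
      no-multi v eq = ℕₚ.<⇒≱ (ℕₚ.m≤m+n 5 1) (ℕₚ.≤-trans (multi-enough eq) (receipt≤4 v))

      -- An eliminator for the class of a neighbour. With `c` and `d` concrete the payments compute,
      -- so pairs that leave part of the 3 unspent are dismissed by absurd patterns.
      neighbour-class : ∀ {v c u} → cls v ≡ c → v ~ u → ∀ {Q : Class → Set} →
                        (∀ d → d ≢ multi → 3 ≤ pay c d + pay d c → Q d) → Q (cls u)
      neighbour-class {u = u} refl v~u find = find (cls u) (no-multi u) (pay-tight v~u)

      extremal : Extremal G cls
      extremal = record
        { no-multi       = no-multi
        ; chosen-nbr     = λ eq v~u → neighbour-class eq v~u {_≡ single} λ where
            chosen _  ()
            single _  _ → refl
            multi  ¬m _ → ⊥-elim (¬m refl)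
            far    _  ()
        ; chosen-two     = λ {v} eq →
            let x , v~x       = neighbour v
                u , u≢x , v~u = another-neighbour G v~x (chosen-not-leaf eq)
            in u , x , u≢x , v~u , v~x
        ; single-nbr     = λ eq v~u → neighbour-class eq v~u {λ d → d ≡ chosen ⊎ d ≡ far} λ where
            chosen _  _ → inj₁ refl
            single _  (s≤s (s≤s ()))
            multi  ¬m _ → ⊥-elim (¬m refl)
            far    _  _ → inj₂ refl
        ; single-chosen  = λ eq → case asClass eq of λ where
            (_ , x , (v~x , x∈D) , _) → x , v~x , chosen-if x∈D
        ; single-chosen! = λ eq v~x v~y x-chosen y-chosen → case asClass eq of λ where
            (_ , _ , _ , only) → trans (only v~x (asClass x-chosen)) (sym (only v~y (asClass y-chosen)))
        ; single-far!    = single-far!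
        ; far-nbr        = λ eq v~u → neighbour-class eq v~u {_≡ single} λ where
            chosen _  ()
            single _  _ → refl
            multi  ¬m _ → ⊥-elim (¬m refl)
            far    _  (s≤s (s≤s ()))
        ; far-another    = far-another
        ; far-only       = far-only
        }
        where
        far≢chosen : ∀ {c} → c ≡ far → c ≢ chosen
        far≢chosen refl ()

        far-pays : ∀ {v u} → cls v ≡ far → v ~ u → 2 ≤ flow u v
        far-pays {v} {u} eq v~u = ℕₚ.≤-trans
          (neighbour-class eq v~u {λ d → 2 ≤ pay d far} λ where
            chosen _  ()
            single _  _ → ℕₚ.≤-refl
            multi  ¬m _ → ⊥-elim (¬m refl)
            far    _  (s≤s (s≤s ())))
          (pay≤flow v~u refl eq)

        -- A leaf in `D` would have income at least 1 + 4.
        chosen-not-leaf : ∀ {v} → cls v ≡ chosen → degree G v ≢ 1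
        chosen-not-leaf {v} eq deg≡1 = ℕₚ.<⇒≱ (ℕₚ.n<1+n 4) (begin
          5                                  ≡⟨ cong₂ (λ x y → x + 4 * y) (𝟙-yes (degree G v ℕₚ.≟ 1) deg≡1) (𝟙-yes (v ∈? D) (asClass eq)) ⟨
          leaf v + member v                  ≤⟨ ℕₚ.+-monoˡ-≤ (member v) (ℕₚ.m≤n+m (leaf v) (receipt v)) ⟩
          receipt v + leaf v + member v      ≤⟨ income≤4 v ⟩
          4                                  ∎)
          where open ℕₚ.≤-Reasoning

        -- The neighbour in `D` passes 3 and every far neighbour 1, so two far neighbours would
        -- bring the receipt to 5.
        single-far! : ∀ {v x y} → cls v ≡ single → v ~ x → v ~ y → cls x ≡ far → cls y ≡ far → x ≡ y
        single-far! {v} {x} {y} eq v~x v~y x-far y-far with asClass eq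
        ... | _ , z , (v~z , z∈D) , _ = decidable-stable (x ≟ y) λ x≢y → ℕₚ.<⇒≱ (ℕₚ.n<1+n 4) (begin
          3 + (1 + 1)                        ≤⟨ ℕₚ.+-mono-≤ (pay≤flow v~z (chosen-if z∈D) eq)
                                                  (ℕₚ.+-mono-≤ (pay≤flow v~x x-far eq) (pay≤flow v~y y-far eq)) ⟩
          flow z v + (flow x v + flow y v)   ≤⟨ three≤sum (λ u → flow u v)
                                                  (λ { refl → far≢chosen x-far (chosen-if z∈D) })
                                                  (λ { refl → far≢chosen y-far (chosen-if z∈D) })
                                                  (x≢y ∘ sym) ⟩
          receipt v                          ≤⟨ receipt≤4 v ⟩
          4                                  ∎)
          where open ℕₚ.≤-Reasoning

        -- Without `multi` vertices the two midpoints of `far-view` are distinct, so one of them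
        -- differs from `x`.
        far-another : ∀ {v x} → cls v ≡ far → v ~ x → ∃[ u ] u ≢ x × v ~ u
        far-another {v} {x} eq v~x with far-view eq
        ... | inj₂ (a , _ , a-multi) = ⊥-elim (no-multi a a-multi)
        ... | inj₁ (a , b , b≢a , (v~a , _) , (v~b , _)) with a ≟ x
        ...   | yes refl = b , b≢a , v~b
        ...   | no  a≢x  = a , a≢x , v~a

        -- Each neighbour passes at least 2, so a third one would bring the receipt to 6.
        far-only : ∀ {v a b u} → cls v ≡ far → v ~ a → v ~ b → b ≢ a → v ~ u → u ≡ a ⊎ u ≡ b
        far-only {v} {a} {b} {u} eq v~a v~b b≢a v~u with u ≟ a | u ≟ b
        ... | yes u≡a | _       = inj₁ u≡a
        ... | no  _   | yes u≡b = inj₂ u≡b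
        ... | no  u≢a | no  u≢b = ⊥-elim (ℕₚ.<⇒≱ (ℕₚ.m≤m+n 5 1) (ℕₚ.≤-trans
          (ℕₚ.+-mono-≤ (far-pays eq v~a) (ℕₚ.+-mono-≤ (far-pays eq v~b) (far-pays eq v~u)))
          (ℕₚ.≤-trans (three≤sum (λ u → flow u v) b≢a u≢a u≢b) (receipt≤4 v))))

-- Growing a tree one pendant vertex at a time

module _ (G : Graph n) where
  open Graph G

  -- For loop erasure: when the start of a walk recurs on the path already built, the path is cut
  -- back to that occurrence.
  suffix : ∀ {u v x} (w : Walk G u v) → Unique (vertices w) → x L.∈ vertices w →
           Σ[ w′ ∈ Walk G x v ] Unique (vertices w′)
  suffix ε       unique       (here refl) = ε , unique
  suffix (e ◅ w) unique       (here refl) = e ◅ w , unique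
  suffix (e ◅ w) (_ ∷ unique) (there x∈w) = suffix w unique x∈w

  walk⇒path : ∀ {u v} → Walk G u v → Σ[ w ∈ Walk G u v ] Unique (vertices w)
  walk⇒path ε = ε , [] ∷ []
  walk⇒path {u} (e ◅ w) with walk⇒path w
  ... | w′ , unique with DecL._∈?_ _≟_ u (vertices w′)
  ...   | yes u∈w′ = suffix w′ unique u∈w′
  ...   | no  u∉w′ = e ◅ w′ , ¬Any⇒All¬ (vertices w′) u∉w′ ∷ unique

-- For injective `f` this is the subgraph induced on the image of `f`, renumbered along `f`.
pull : Graph n → (Fin m → Fin n) → Graph m
pull G f = record
  { _~_   = λ i j → f i ~ f j
  ; _~?_  = λ i j → f i ~? f j
  ; ~-sym = ~-sym
  ; ~-irr = λ i → ~-irr (f i)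
  }
  where open Graph G

infix 4 _≈_

-- Graphs constructed differently on the same vertices have adjacency types that are equivalent but
-- not equal; membership in `𝒯₁` is carried across by `iso` with the identity permutation.
record _≈_ {n} (G H : Graph n) : Set where
  field
    adjacent : ∀ u v → Graph._~_ G u v ⇔ Graph._~_ H u v

open _≈_

≈-trans : {G H K : Graph n} → G ≈ H → H ≈ K → G ≈ K
≈-trans G≈H H≈K .adjacent u v =
  mk⇔ (to (adjacent H≈K u v) ∘ to (adjacent G≈H u v)) (from (adjacent G≈H u v) ∘ from (adjacent H≈K u v))
  where open Equivalence

addPendant-cong : {G H : Graph n} → G ≈ H → ∀ v → addPendant G v ≈ addPendant H v
addPendant-cong G≈H v .adjacent zero    zero    = mk⇔ id id
addPendant-cong G≈H v .adjacent zero    (suc y) = mk⇔ id id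
addPendant-cong G≈H v .adjacent (suc x) zero    = mk⇔ id id
addPendant-cong G≈H v .adjacent (suc x) (suc y) = adjacent G≈H x y

𝒯₁-≈ : {G H : Graph n} {S : Labeling n} → G ≈ H → 𝒯₁ ⟨ G , S ⟩ → 𝒯₁ ⟨ H , S ⟩
𝒯₁-≈ G≈H = iso record { π = idₚ ; preserve = adjacent G≈H ; sta-≡ = λ _ → refl }

_avoids_ : (Fin m → Fin n) → Fin n → Set
f avoids y = ∀ i → f i ≢ y

pushforward : (G : Graph n) (f : Fin m → Fin n) {i j : Fin m} → Walk (pull G f) i j → Walk G (f i) (f j)
pushforward G f = gmap f id

vertices-pushforward : (G : Graph n) (f : Fin m → Fin n) {i j : Fin m} (w : Walk (pull G f) i j) →
                       vertices (pushforward G f w) ≡ List.map f (vertices w)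
vertices-pushforward G f ε           = refl
vertices-pushforward G f {i} (_ ◅ w) = cong (f i ∷_) (vertices-pushforward G f w)

record Subtree (G : Graph n) (f : Fin m → Fin n) : Set where
  field
    injective : ∀ {i j} → f i ≡ f j → i ≡ j
    joined    : Connected (pull G f)

module Growing (G : Graph n) (tree : IsTree G) where
  open Graph G
  open IsTree tree
  open Subtree

  -- Two distinct neighbours of `y` in the subtree are joined by a path inside it, which `y` would
  -- close to a cycle.
  attached-once : {f : Fin m → Fin n} → Subtree G f → ∀ {y} → f avoids y →
                  ∀ {i j} → y ~ f i → y ~ f j → i ≡ j
  attached-once {f = f} sub {y} y∉f {i} {j} y~i y~j = decidable-stable (i ≟ j) λ i≢j →
    let w , unique = walk⇒path (pull G f) (joined sub i j)
    in acyclic (y~i ◅ pushforward G f w)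
         (subst Unique (sym (cong (y ∷_) (vertices-pushforward G f w)))
           (mapᴬ⁺ (All.universal (λ k y≡fk → y∉f k (sym y≡fk)) (vertices w)) ∷ mapᵁ⁺ (injective sub) unique))
         (s≤s (long w i≢j)) (~-sym y~j)
    where
    long : ∀ {i j} (w : Walk (pull G f) i j) → i ≢ j → 1 ≤ length (pushforward G f w)
    long ε       i≢i = ⊥-elim (i≢i refl)
    long (_ ◅ _) _   = s≤s z≤n

  module _ {f : Fin m → Fin n} (sub : Subtree G f) {y} (y∉f : f avoids y) {i} (y~i : y ~ f i) where

    attach-subtree : Subtree G (y F.∷ f)
    attach-subtree = record { injective = inj _ _ ; joined = conn }
      where
      inj : ∀ i j → (y F.∷ f) i ≡ (y F.∷ f) j → i ≡ j
      inj zero    zero    _  = refl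
      inj zero    (suc j) eq = ⊥-elim (y∉f j (sym eq))
      inj (suc i) zero    eq = ⊥-elim (y∉f i eq)
      inj (suc i) (suc j) eq = cong suc (injective sub eq)

      old : ∀ j k → Walk (pull G (y F.∷ f)) (suc j) (suc k)
      old j k = pushforward (pull G (y F.∷ f)) suc (joined sub j k)

      conn : Connected (pull G (y F.∷ f))
      conn zero    zero    = ε
      conn zero    (suc k) = y~i ◅ old i k
      conn (suc j) zero    = old j i ◅◅ (~-sym y~i ◅ ε)
      conn (suc j) (suc k) = old j k

    -- By `attached-once` the induced subgraph gains only the edge from `y` to `f i`.
    attach-≈ : addPendant (pull G f) i ≈ pull G (y F.∷ f)
    attach-≈ .adjacent zero    zero    = mk⇔ (λ ()) (~-irr y)
    attach-≈ .adjacent zero    (suc k) = mk⇔ (λ { refl → y~i }) (λ y~k → attached-once sub y∉f y~k y~i)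
    attach-≈ .adjacent (suc j) zero    = mk⇔ (λ { refl → ~-sym y~i }) (λ j~y → attached-once sub y∉f (~-sym j~y) y~i)
    attach-≈ .adjacent (suc j) (suc k) = mk⇔ id id

  single-vertex-subtree : ∀ r → Subtree {m = 1} G (r F.∷ F.[])
  single-vertex-subtree r = record { injective = λ { {0F} {0F} _ → refl } ; joined = λ { 0F 0F → ε } }

  attach-avoids : {f : Fin m → Fin n} {y z : Fin n} → f avoids z → z ≢ y → (y F.∷ f) avoids z
  attach-avoids z∉f z≢y zero    = z≢y ∘ sym
  attach-avoids z∉f z≢y (suc i) = z∉f i

  -- A walk from `f r` to `y` is followed until it first leaves the image.
  boundary : {f : Fin m → Fin n} → Fin m → ∀ {y} → f avoids y → ∃₂ λ i z → f avoids z × z ~ f i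
  boundary {f = f} r {y} y∉f = go r refl (connected (f r) y)
    where
    go : ∀ {u} i → u ≡ f i → Walk G u y → ∃₂ λ i z → f avoids z × z ~ f i
    go i refl ε = ⊥-elim (y∉f i refl)
    go i refl (_◅_ {j = x} fi~x w) with any? (λ j → f j ≟ x)
    ... | yes (j , fj≡x) = go j (sym fj≡x) w
    ... | no  x∉f        = i , x , (λ k fk≡x → x∉f (k , fk≡x)) , ~-sym fi~x

  -- The step is repeated until the image is everything; `f` is then a bijection, which forces `m`
  -- to equal `n`. Termination is by the fuel `d`, kept so that `n ≤ m + d`.
  grow : ∀ {ℓ} (P : ∀ {m} → (Fin m → Fin n) → Set ℓ) →
         (∀ {m} {f : Fin m → Fin n} → P f → Subtree G f) →
         (∀ {m} {f : Fin m → Fin n} → P f → ∀ {y} → f avoids y →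
            ∃₂ λ m′ (f′ : Fin m′ → Fin n) → m < m′ × P f′) →
         ∀ {m} {f : Fin m → Fin n} → P f → ∃[ π ] P {n} (π ⟨$⟩ʳ_)
  grow P sub step {m} = go n (ℕₚ.m≤n+m n m)
    where
    onto : ∀ {m} (π : Permutation m n) → P (π ⟨$⟩ʳ_) → ∃[ π ] P {n} (π ⟨$⟩ʳ_)
    onto π p with refl ← ↔⇒≡ π = π , p

    go : ∀ d {m} → n ≤ m + d → {f : Fin m → Fin n} → P f → ∃[ π ] P {n} (π ⟨$⟩ʳ_)
    go d {m} n≤m+d {f} p with all? (λ y → any? (λ i → f i ≟ y))
    ... | yes surjective = onto (permutation f (proj₁ ∘ surjective) (proj₂ ∘ surjective)
            (λ i → injective (sub p) (proj₂ (surjective (f i))))) p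
    ... | no ¬surjective with ¬∀⟶∃¬ n _ (λ y → any? (λ i → f i ≟ y)) ¬surjective
    ...   | y , y∉f with step p (λ i fi≡y → y∉f (i , fi≡y))
    -- Out of fuel, `n ≤ m < m′` contradicts the injectivity of `f′`.
    go zero    n≤m+0 p | no _ | _ | m′ , f′ , m<m′ , p′ =
      ⊥-elim (ℕₚ.<⇒≱ m<m′ (ℕₚ.≤-trans (injective⇒≤ (injective (sub p′)))
        (ℕₚ.≤-trans n≤m+0 (ℕₚ.≤-reflexive (ℕₚ.+-identityʳ _)))))
    go (suc d) {m} n≤m+d p | no _ | _ | m′ , f′ , m<m′ , p′ = go d (begin
      n             ≤⟨ n≤m+d ⟩
      m + suc d     ≡⟨ ℕₚ.+-suc m d ⟩
      suc m + d     ≤⟨ ℕₚ.+-monoˡ-≤ d m<m′ ⟩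
      m′ + d        ∎) p′
      where open ℕₚ.≤-Reasoning

-- The degree sum of a tree

degree-permute : {G H : Graph n} (π : Permutation′ n) →
                 (∀ u v → Graph._~_ G u v ⇔ Graph._~_ H (π ⟨$⟩ʳ u) (π ⟨$⟩ʳ v)) →
                 ∀ u → degree G u ≡ degree H (π ⟨$⟩ʳ u)
degree-permute {G = G} {H} π preserve u = begin
  degree G u                                                      ≡⟨ degree≡sum G u ⟩
  sum (λ v → 𝟙 (Graph._~?_ G u v))                                ≡⟨ sum-cong-≗ (λ v → 𝟙-cong (Graph._~?_ G u v) (Graph._~?_ H (π ⟨$⟩ʳ u) (π ⟨$⟩ʳ v))
                                                                       (to (preserve u v)) (from (preserve u v))) ⟩
  sum (λ v → 𝟙 (Graph._~?_ H (π ⟨$⟩ʳ u) (π ⟨$⟩ʳ v)))              ≡⟨ ∑-permute (λ v → 𝟙 (Graph._~?_ H (π ⟨$⟩ʳ u) v)) π ⟨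
  sum (λ v → 𝟙 (Graph._~?_ H (π ⟨$⟩ʳ u) v))                       ≡⟨ degree≡sum H (π ⟨$⟩ʳ u) ⟨
  degree H (π ⟨$⟩ʳ u)                                             ∎
  where
  open ≡-Reasoning
  open Equivalence

module Handshake (G : Graph n) (tree : IsTree G) where
  open Graph G
  open Growing G tree

  ∑adjacent : (Fin m → Fin n) → ℕ
  ∑adjacent f = sum (λ i → sum (λ j → 𝟙 (f i ~? f j)))

  -- The degree sum of the subtree, without subtraction. Attaching a vertex adds 2 to both sides.
  Counted : (Fin m → Fin n) → Set
  Counted {m} f = Subtree G f × ∑adjacent f + 2 ≡ m + m

  single-vertex : ∀ r → Counted {1} (r F.∷ F.[])
  single-vertex r =
    single-vertex-subtree r ,
    cong (λ x → x + 0 + 0 + 2) (𝟙-no (r ~? r) (~-irr r))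

  count-attach : {f : Fin m → Fin n} → Counted f → ∀ {y} → f avoids y → ∀ {i} → y ~ f i → Counted (y F.∷ f)
  count-attach {m} {f} (sub , count) {y} y∉f {i} y~i = attach-subtree sub y∉f y~i , (begin
    𝟙 (y ~? y) + sum (λ j → 𝟙 (y ~? f j)) + sum (λ j → 𝟙 (f j ~? y) + row j) + 2
      ≡⟨ cong₂ (λ a b → a + b + sum (λ j → 𝟙 (f j ~? y) + row j) + 2) (𝟙-no (y ~? y) (~-irr y))
           (sum-𝟙-unique (λ j → y ~? f j) y~i (λ y~j → attached-once sub y∉f y~j y~i)) ⟩
    1 + sum (λ j → 𝟙 (f j ~? y) + row j) + 2
      ≡⟨ cong (λ a → 1 + a + 2) (∑-distrib-+ (λ j → 𝟙 (f j ~? y)) row) ⟩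
    1 + (sum (λ j → 𝟙 (f j ~? y)) + ∑adjacent f) + 2
      ≡⟨ cong (λ a → 1 + (a + ∑adjacent f) + 2)
           (sum-𝟙-unique (λ j → f j ~? y) (~-sym y~i) (λ j~y → attached-once sub y∉f (~-sym j~y) y~i)) ⟩
    2 + (∑adjacent f + 2)
      ≡⟨ cong (2 +_) count ⟩
    2 + (m + m)
      ≡⟨ cong suc (ℕₚ.+-suc m m) ⟨
    suc m + suc m ∎)
    where
    open ≡-Reasoning
    row : Fin m → ℕ
    row j = sum (λ k → 𝟙 (f j ~? f k))

  handshake : Fin n → sum (degree G) + 2 ≡ n + n
  handshake r = case grow Counted proj₁ step (single-vertex r) of λ where
      (π , _ , count) → trans (cong (_+ 2) (total π)) count
    where
    occupied : {f : Fin m → Fin n} → Counted f → Fin m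
    occupied {suc m} _        = 0F
    -- An empty image would make the count read 0 + 2 = 0.
    occupied {zero}  (_ , ())

    step : ∀ {m} {f : Fin m → Fin n} → Counted f → ∀ {y} → f avoids y →
           ∃₂ λ m′ (f′ : Fin m′ → Fin n) → m < m′ × Counted f′
    step counted y∉f with boundary (occupied counted) y∉f
    ... | i , z , z∉f , z~i = _ , _ , ℕₚ.n<1+n _ , count-attach counted z∉f z~i

    total : ∀ π → sum (degree G) ≡ ∑adjacent (π ⟨$⟩ʳ_)
    total π = begin
      sum (degree G)                        ≡⟨ ∑-permute (degree G) π ⟩
      sum (λ i → degree G (π ⟨$⟩ʳ i))       ≡⟨ sum-cong-≗ (degree-permute {G = pull G (π ⟨$⟩ʳ_)} {G} π (λ _ _ → mk⇔ id id)) ⟨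
      sum (degree (pull G (π ⟨$⟩ʳ_)))       ≡⟨ sum-cong-≗ (degree≡sum (pull G (π ⟨$⟩ʳ_))) ⟩
      ∑adjacent (π ⟨$⟩ʳ_)                   ∎
      where open ≡-Reasoning

-- Regrowing an extremal tree

infix 4 _covers_

_covers_ : (Fin m → Fin n) → Fin n → Set
f covers y = ∃[ i ] f i ≡ y

module ExtremalTree (G : Graph n) (tree : IsTree G) {cls : Fin n → Class} (extremal : Extremal G cls) where
  open Graph G
  open Growing G tree
  open Extremal extremal

  -- By `chosen-in` and `far-in` an edge leaving the image starts at a chosen vertex or runs from a
  -- `single` vertex to a far one, the situations of `𝒪₁` and `𝒪₃`. The last two fields provide the
  -- statuses these operations require; `single-C` asks only about vertices with a neighbour still
  -- outside, since a completed one may have status `B`.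
  record Grown {m} (f : Fin m → Fin n) : Set₁ where
    field
      subtree   : Subtree G f
      root      : Fin m
      labels    : Labeling m
      in-𝒯₁     : 𝒯₁ ⟨ pull G f , labels ⟩
      chosen-in : ∀ i {y} → cls (f i) ≡ single → f i ~ y → cls y ≡ chosen → f covers y
      far-in    : ∀ i {y} → cls (f i) ≡ far → f i ~ y → f covers y
      chosen-A  : ∀ i → cls (f i) ≡ chosen → labels i ≡ A
      single-C  : ∀ i {y} → cls (f i) ≡ single → f avoids y → f i ~ y → labels i ≡ C

  class-≢ : ∀ {u v c d} → cls u ≡ c → cls v ≡ d → c ≢ d → u ≢ v
  class-≢ refl refl c≢d refl = c≢d refl

  module _ {f : Fin m → Fin n} (g : Grown f) {i} (fi-chosen : cls (f i) ≡ chosen)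
           {y} (y∉f : f avoids y) (y~i : y ~ f i) where
    open Grown g

    private
      y-single : cls y ≡ single
      y-single = chosen-nbr fi-chosen (~-sym y~i)

    grow-𝒪₁ : Grown (y F.∷ f)
    grow-𝒪₁ = record
      { subtree   = attach-subtree subtree y∉f y~i
      ; root      = 0F
      ; labels    = C ∷ᴸ labels
      ; in-𝒯₁     = 𝒯₁-≈ (attach-≈ subtree y∉f y~i) (step₁ i (chosen-A i fi-chosen) in-𝒯₁)
      ; chosen-in = λ where
          -- The only chosen neighbour of `y` is `f i`, already inside.
          zero    s y~x x-chosen → suc i , single-chosen! s y~i y~x fi-chosen x-chosen
          (suc j) s j~x x-chosen → let k , eq = chosen-in j s j~x x-chosen in suc k , eq
      ; far-in    = λ where
          zero    y-far _   → ⊥-elim (class-≢ y-far y-single (λ ()) refl)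
          (suc j) j-far j~x → let k , eq = far-in j j-far j~x in suc k , eq
      ; chosen-A  = λ where
          zero    y-chosen → ⊥-elim (class-≢ y-chosen y-single (λ ()) refl)
          (suc j) j-chosen → chosen-A j j-chosen
      ; single-C  = λ where
          zero    _ _   _   → refl
          (suc j) s x∉f j~x → single-C j s (x∉f ∘ suc) j~x
      }

  -- Beyond the far vertex y lie its other neighbour c, the chosen neighbour z
  -- of c, and another neighbour e of z.
  module _ {f : Fin m → Fin n} (g : Grown f) {i} (fi-single : cls (f i) ≡ single)
           {y c z e} (y∉f : f avoids y) (y~i : y ~ f i) (y-far : cls y ≡ far)
           (c≢fi : c ≢ f i) (y~c : y ~ c) (c~z : c ~ z) (z-chosen : cls z ≡ chosen)
           (e≢c : e ≢ c) (z~e : z ~ e) where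
    open Grown g
    open Subtree

    private
      c-single : cls c ≡ single
      c-single = far-nbr y-far y~c
      e-single : cls e ≡ single
      e-single = chosen-nbr z-chosen z~e

      f₁ : Fin (1 + m) → Fin n
      f₁ = y F.∷ f
      f₂ : Fin (2 + m) → Fin n
      f₂ = c F.∷ f₁
      f₃ : Fin (3 + m) → Fin n
      f₃ = z F.∷ f₂
      f₄ : Fin (4 + m) → Fin n
      f₄ = e F.∷ f₃

      sub₁ : Subtree G f₁
      sub₁ = attach-subtree subtree y∉f y~i

      c∉f₁ : f₁ avoids c
      c∉f₁ = attach-avoids
        -- If `c` were in the image of `f`, then `y` would have two neighbours there.
        (λ { j refl → c≢fi (cong f (attached-once subtree y∉f y~c y~i)) })
        (class-≢ c-single y-far λ ())

      sub₂ : Subtree G f₂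
      sub₂ = attach-subtree sub₁ c∉f₁ {0F} (~-sym y~c)

      z∉f₂ : f₂ avoids z
      z∉f₂ = attach-avoids (attach-avoids
        -- The vertex `c` already meets the subtree at `y`, so its neighbour `z` lies outside. The
        -- same argument, with `z` meeting it at `c`, later keeps `e` outside.
        (λ { j refl → 0≢1+n (attached-once sub₁ c∉f₁ {0F} {suc j} (~-sym y~c) c~z) })
        (class-≢ z-chosen y-far λ ()))
        (class-≢ z-chosen c-single λ ())

      sub₃ : Subtree G f₃
      sub₃ = attach-subtree sub₂ z∉f₂ {0F} (~-sym c~z)

      e∉f₃ : f₃ avoids e
      e∉f₃ = attach-avoids (attach-avoids (attach-avoids
        (λ { j refl → 0≢1+n (attached-once sub₂ z∉f₂ {0F} {suc (suc j)} (~-sym c~z) z~e) })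
        (class-≢ e-single y-far λ ()))
        e≢c)
        (class-≢ e-single z-chosen λ ())

      graph-≈ : LabeledGraph.graph (𝒪₃ ⟨ pull G f , labels ⟩ i) ≈ pull G f₄
      graph-≈ =
        extend (extend (extend (attach-≈ subtree y∉f y~i)
          (attach-≈ sub₁ c∉f₁ (~-sym y~c))) (attach-≈ sub₂ z∉f₂ (~-sym c~z))) (attach-≈ sub₃ e∉f₃ (~-sym z~e))
        where
        extend : ∀ {k} {H K : Graph k} {L v} → H ≈ K → addPendant K v ≈ L → addPendant H v ≈ L
        extend H≈K = ≈-trans (addPendant-cong H≈K _)

      -- The unique chosen neighbour of `f i` is inside by `chosen-in`. Any other neighbour is far,
      -- hence equal to `y`, which is still outside.
      fi-end : degree (pull G f) i ≡ 1
      fi-end with single-chosen fi-single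
      ... | x , fi~x , x-chosen with chosen-in i fi-single fi~x x-chosen
      ...   | j , refl = degree≡1 (pull G f) {i} {j} fi~x λ {k} i~k →
        case single-nbr fi-single i~k of λ where
          (inj₁ k-chosen) → injective subtree (single-chosen! fi-single i~k fi~x k-chosen x-chosen)
          (inj₂ k-far)    → ⊥-elim (y∉f k (single-far! fi-single i~k (~-sym y~i) k-far y-far))

    grow-𝒪₃ : Grown (e F.∷ z F.∷ c F.∷ y F.∷ f)
    grow-𝒪₃ = record
      { subtree   = attach-subtree sub₃ e∉f₃ {0F} (~-sym z~e)
      ; root      = 0F
      ; labels    = C ∷ᴸ A ∷ᴸ B ∷ᴸ D ∷ᴸ labels
      ; in-𝒯₁     = 𝒯₁-≈ graph-≈ (step₃ i (single-C i fi-single y∉f (~-sym y~i)) fi-end in-𝒯₁)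
      ; chosen-in = λ where
          0F s e~x x-chosen → 1F , single-chosen! s (~-sym z~e) e~x z-chosen x-chosen
          1F s _   _        → ⊥-elim (class-≢ s z-chosen (λ ()) refl)
          2F s c~x x-chosen → 1F , single-chosen! s c~z c~x z-chosen x-chosen
          3F s _   _        → ⊥-elim (class-≢ s y-far (λ ()) refl)
          (suc (suc (suc (suc j)))) s j~x x-chosen →
            let k , eq = chosen-in j s j~x x-chosen in suc (suc (suc (suc k))) , eq
      ; far-in    = λ where
          0F e-far _   → ⊥-elim (class-≢ e-far e-single (λ ()) refl)
          1F z-far _   → ⊥-elim (class-≢ z-far z-chosen (λ ()) refl)
          2F c-far _   → ⊥-elim (class-≢ c-far c-single (λ ()) refl)
          3F _     y~x → case far-only y-far y~i y~c c≢fi y~x of λ where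
            (inj₁ refl) → suc (suc (suc (suc i))) , refl
            (inj₂ refl) → 2F , refl
          (suc (suc (suc (suc j)))) j-far j~x →
            let k , eq = far-in j j-far j~x in suc (suc (suc (suc k))) , eq
      ; chosen-A  = λ where
          0F e-chosen → ⊥-elim (class-≢ e-chosen e-single (λ ()) refl)
          1F _        → refl
          2F c-chosen → ⊥-elim (class-≢ c-chosen c-single (λ ()) refl)
          3F y-chosen → ⊥-elim (class-≢ y-chosen y-far (λ ()) refl)
          (suc (suc (suc (suc j)))) → chosen-A j
      ; single-C  = λ where
          0F _ _   _   → refl
          1F s _   _   → ⊥-elim (class-≢ s z-chosen (λ ()) refl)
          -- The vertex `c` has status `B`, but the claim is vacuous for it: its only neighbours are
          -- `z` and `y`, both inside.
          2F s x∉f c~x → case single-nbr s c~x of λ where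
            (inj₁ x-chosen) → ⊥-elim (x∉f 1F (single-chosen! s c~z c~x z-chosen x-chosen))
            (inj₂ x-far)    → ⊥-elim (x∉f 3F (single-far! s (~-sym y~c) c~x y-far x-far))
          3F s _   _   → ⊥-elim (class-≢ s y-far (λ ()) refl)
          (suc (suc (suc (suc j)))) s x∉f j~x → single-C j s (λ k → x∉f (suc (suc (suc (suc k))))) j~x
      }

  chosen-another : ∀ {z} c → cls z ≡ chosen → ∃[ e ] e ≢ c × z ~ e
  chosen-another c z-chosen with chosen-two z-chosen
  ... | a , b , a≢b , z~a , z~b with a ≟ c
  ...   | yes refl = b , a≢b ∘ sym , z~b
  ...   | no  a≢c  = a , a≢c , z~a

  -- The class of the inner end of an edge leaving the image decides the operation. From a `single`
  -- vertex the edge leads to a far one, whose second neighbour supplies the rest of the path for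
  -- `𝒪₃`.
  grow-step : ∀ {m} {f : Fin m → Fin n} → Grown f → ∀ {y} → f avoids y →
              ∃₂ λ m′ (f′ : Fin m′ → Fin n) → m < m′ × Grown f′
  grow-step {m} {f} g x∉f with boundary (Grown.root g) x∉f
  ... | i , y , y∉f , y~i = go (cls (f i)) refl
    where
    go : ∀ c → cls (f i) ≡ c → ∃₂ λ m′ (f′ : Fin m′ → Fin n) → m < m′ × Grown f′
    go chosen eq = _ , _ , ℕₚ.n<1+n m , grow-𝒪₁ g eq y∉f y~i
    go multi  eq = ⊥-elim (no-multi _ eq)
    go far    eq = case Grown.far-in g i eq (~-sym y~i) of λ where
      (j , fj≡y) → ⊥-elim (y∉f j fj≡y)
    go single eq with single-nbr eq (~-sym y~i)
    ... | inj₁ y-chosen = case Grown.chosen-in g i eq (~-sym y~i) y-chosen of λ where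
      (j , fj≡y) → ⊥-elim (y∉f j fj≡y)
    ... | inj₂ y-far with far-another y-far y~i
    ...   | c , c≢fi , y~c with single-chosen (far-nbr y-far y~c)
    ...     | z , c~z , z-chosen with chosen-another c z-chosen
    ...       | e , e≢c , z~e = _ , _ , ℕₚ.m≤n+m (suc m) 3 ,
      grow-𝒪₃ g eq y∉f y~i y-far c≢fi y~c c~z z-chosen e≢c z~e

  -- The initial `P₃` is a chosen vertex with two of its neighbours. These are `single`, hence not
  -- adjacent to each other.
  star : ∀ {x} → cls x ≡ chosen → ∃[ f ] Grown {3} f
  star {x} x-chosen with chosen-two x-chosen
  ... | a , b , a≢b , x~a , x~b = a F.∷ x F.∷ b F.∷ F.[] , record
    { subtree   = attach-subtree
        (attach-subtree (single-vertex-subtree b) {x} (λ { 0F b≡x → b≢x b≡x }) {0F} x~b)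
        {a} (λ { 0F x≡a → a≢x (sym x≡a) ; 1F b≡a → a≢b (sym b≡a) }) {0F} (~-sym x~a)
    ; root      = 0F
    ; labels    = LabeledGraph.sta P₃
    ; in-𝒯₁     = 𝒯₁-≈ path-≈ base
    ; chosen-in = λ where
        0F s a~y y-chosen → 1F , single-chosen! s (~-sym x~a) a~y x-chosen y-chosen
        1F s _   _        → ⊥-elim (class-≢ s x-chosen (λ ()) refl)
        2F s b~y y-chosen → 1F , single-chosen! s (~-sym x~b) b~y x-chosen y-chosen
    ; far-in    = λ where
        0F a-far _ → ⊥-elim (class-≢ a-far a-single (λ ()) refl)
        1F x-far _ → ⊥-elim (class-≢ x-far x-chosen (λ ()) refl)
        2F b-far _ → ⊥-elim (class-≢ b-far b-single (λ ()) refl)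
    ; chosen-A  = λ where
        0F a-chosen → ⊥-elim (class-≢ a-chosen a-single (λ ()) refl)
        1F _        → refl
        2F b-chosen → ⊥-elim (class-≢ b-chosen b-single (λ ()) refl)
    ; single-C  = λ where
        0F _ _ _ → refl
        1F s _ _ → ⊥-elim (class-≢ s x-chosen (λ ()) refl)
        2F _ _ _ → refl
    }
    where
    a-single : cls a ≡ single
    a-single = chosen-nbr x-chosen x~a
    b-single : cls b ≡ single
    b-single = chosen-nbr x-chosen x~b
    a≢x : a ≢ x
    a≢x = class-≢ a-single x-chosen λ ()
    b≢x : b ≢ x
    b≢x = class-≢ b-single x-chosen λ ()

    single≁single : ∀ {u v} → cls u ≡ single → cls v ≡ single → ¬ (u ~ v)
    single≁single u-single v-single u~v = case single-nbr u-single u~v of λ where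
      (inj₁ v-chosen) → class-≢ v-single v-chosen (λ ()) refl
      (inj₂ v-far)    → class-≢ v-single v-far (λ ()) refl

    path-≈ : pathGraph 3 ≈ pull G (a F.∷ x F.∷ b F.∷ F.[])
    path-≈ .adjacent 0F 0F = mk⇔ (λ { (inj₁ ()) ; (inj₂ ()) }) (⊥-elim ∘ ~-irr a)
    path-≈ .adjacent 0F 1F = mk⇔ (λ _ → ~-sym x~a) (λ _ → inj₁ refl)
    path-≈ .adjacent 0F 2F = mk⇔ (λ { (inj₁ ()) ; (inj₂ ()) }) (⊥-elim ∘ single≁single a-single b-single)
    path-≈ .adjacent 1F 0F = mk⇔ (λ _ → x~a) (λ _ → inj₂ refl)
    path-≈ .adjacent 1F 1F = mk⇔ (λ { (inj₁ ()) ; (inj₂ ()) }) (⊥-elim ∘ ~-irr x)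
    path-≈ .adjacent 1F 2F = mk⇔ (λ _ → x~b) (λ _ → inj₁ refl)
    path-≈ .adjacent 2F 0F = mk⇔ (λ { (inj₁ ()) ; (inj₂ ()) }) (⊥-elim ∘ single≁single b-single a-single)
    path-≈ .adjacent 2F 1F = mk⇔ (λ _ → ~-sym x~b) (λ _ → inj₂ refl)
    path-≈ .adjacent 2F 2F = mk⇔ (λ { (inj₁ ()) ; (inj₂ ()) }) (⊥-elim ∘ ~-irr b)

  some-chosen : ∀ {v u} → v ~ u → ∃[ x ] cls x ≡ chosen
  some-chosen {v} v~u = go (cls v) refl
    where
    near : ∀ {w} → cls w ≡ single → ∃[ x ] cls x ≡ chosen
    near eq = case single-chosen eq of λ where (x , _ , x-chosen) → x , x-chosen

    go : ∀ c → cls v ≡ c → ∃[ x ] cls x ≡ chosen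
    go chosen eq = v , eq
    go single eq = near eq
    go multi  eq = ⊥-elim (no-multi v eq)
    go far    eq = near (far-nbr eq v~u)

  in-𝒯₁ : ∀ {v u} → v ~ u → ∃[ S ] 𝒯₁ ⟨ G , S ⟩
  in-𝒯₁ v~u with star (proj₂ (some-chosen v~u))
  ... | _ , s with grow Grown Grown.subtree grow-step s
  ...   | π , g = Grown.labels g ∘ (π ⟨$⟩ˡ_) , iso record
    { π        = π
    ; preserve = λ _ _ → mk⇔ id id
    ; sta-≡    = λ v → cong (Grown.labels g) (inverseˡ π)
    } (Grown.in-𝒯₁ g)

-- Labeled trees of the family attain the bound

_≟A : (s : Status) → Dec (s ≡ A)
A ≟A = yes refl
B ≟A = no λ ()
C ≟A = no λ ()
D ≟A = no λ ()

module _ (L : LabeledGraph n) where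
  open LabeledGraph L
  open Graph graph

  NearA : Fin n → Set
  NearA v = ∃[ u ] v ~ u × sta u ≡ A

  TwoStepsFromA : Fin n → Fin n → Set
  TwoStepsFromA v x = sta x ≡ A × ∃[ p ] v ~ p × p ~ x

  -- At status A only a neighbour is asked for: it keeps such a vertex from
  -- becoming a leaf when a pendant vertex is joined to it.
  Served : Fin n → Status → Set
  Served v A = ∃[ u ] v ~ u
  Served v B = NearA v
  Served v C = NearA v
  Served v D = ∃₂ λ x y → x ≢ y × TwoStepsFromA v x × TwoStepsFromA v y

  centres : Subset n
  centres = comprehension (λ v → sta v ≟A)

  numA : ℕ
  numA = sum (λ v → 𝟙 (sta v ≟A))

  served⇒neighbour : ∀ {v} s → Served v s → ∃[ u ] v ~ u
  served⇒neighbour A (u , v~u)                           = u , v~u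
  served⇒neighbour B (u , v~u , _)                       = u , v~u
  served⇒neighbour C (u , v~u , _)                       = u , v~u
  served⇒neighbour D (_ , _ , _ , (_ , p , v~p , _) , _) = p , v~p

  at-distance-2 : ∀ {v x} → v ≢ x → ¬ (v ~ x) → TwoStepsFromA v x → Distance graph v x 2
  at-distance-2 v≢x v≁x (_ , _ , v~p , p~x) = (v~p ◅ p~x ◅ ε , refl) , λ where
    ε           → ⊥-elim (v≢x refl)
    (v~x ◅ ε)   → ⊥-elim (v≁x v~x)
    (_ ◅ _ ◅ _) → s≤s (s≤s z≤n)

  centres-dominate : (∀ v → Served v (sta v)) → IsDisjunctiveDominating graph centres
  centres-dominate served v v∉D = go (sta v) (served v) (v∉D ∘ centre)
    where
    centre : ∀ {x} → sta x ≡ A → x ∈ centres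
    centre = ∈-comprehension⁺ (λ v → sta v ≟A)

    near : NearA v → ∃[ u ] v ~ u × u ∈ centres
    near (u , v~u , u-A) = u , v~u , centre u-A

    go : ∀ s → Served v s → s ≢ A →
         (∃[ u ] v ~ u × u ∈ centres)
       ⊎ (∃₂ λ x y → x ≢ y × (x ∈ centres × Distance graph v x 2) × (y ∈ centres × Distance graph v y 2))
    go A _    A≢A = ⊥-elim (A≢A refl)
    go B nearA _  = inj₁ (near nearA)
    go C nearA _  = inj₁ (near nearA)
    go D (x , y , x≢y , 2x , 2y) _ with v ~? x | v ~? y
    -- Two steps do not by themselves give distance 2; if either centre is adjacent to `v`, it
    -- dominates `v` directly, so acyclicity need not be invoked.
    ... | yes v~x | _       = inj₁ (x , v~x , centre (proj₁ 2x))
    ... | no  _   | yes v~y = inj₁ (y , v~y , centre (proj₁ 2y))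
    ... | no  v≁x | no  v≁y = inj₂ (x , y , x≢y , at (proj₁ 2x) v≁x 2x , at (proj₁ 2y) v≁y 2y)
      where
      at : ∀ {z} → sta z ≡ A → ¬ (v ~ z) → TwoStepsFromA v z → z ∈ centres × Distance graph v z 2
      at z-A v≁z 2z = centre z-A , at-distance-2 (λ { refl → v∉D (centre z-A) }) v≁z 2z

module _ {L : LabeledGraph m} {M : LabeledGraph n} (f : Fin m → Fin n)
         (injective : ∀ {u v} → f u ≡ f v → u ≡ v)
         (adjacent : ∀ {u v} → Graph._~_ (LabeledGraph.graph L) u v → Graph._~_ (LabeledGraph.graph M) (f u) (f v))
         (status : ∀ v → LabeledGraph.sta M (f v) ≡ LabeledGraph.sta L v) where

  two-steps-map : ∀ {v x} → TwoStepsFromA L v x → TwoStepsFromA M (f v) (f x)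
  two-steps-map (x-A , p , v~p , p~x) = trans (status _) x-A , f p , adjacent v~p , adjacent p~x

  -- Being served asks only for edges, statuses and distinctness, all of which an injective
  -- status-preserving homomorphism respects. It covers old vertices under both operations as well
  -- as isomorphisms.
  served-map : ∀ {v} s → Served L v s → Served M (f v) s
  served-map A (u , v~u)       = f u , adjacent v~u
  served-map B (u , v~u , u-A) = f u , adjacent v~u , trans (status u) u-A
  served-map C (u , v~u , u-A) = f u , adjacent v~u , trans (status u) u-A
  served-map D (x , y , x≢y , 2x , 2y) =
    f x , f y , x≢y ∘ injective , two-steps-map 2x , two-steps-map 2y

module _ (G : Graph n) (v : Fin n) where

  private
    G⁺ = addPendant G v

  degree-pendant : degree G⁺ 0F ≡ 1
  degree-pendant = degree≡1 G⁺ {0F} {suc v} refl λ { {suc u} u≡v → cong suc u≡v }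

  degree-old : ∀ u → degree G⁺ (suc u) ≡ 𝟙 (u ≟ v) + degree G u
  degree-old u = trans (degree≡sum G⁺ (suc u)) (cong (𝟙 (u ≟ v) +_) (sym (degree≡sum G u)))

  module _ (1≤deg : 1 ≤ degree G v) where

    private
      lost : Fin n → ℕ
      lost u = 𝟙 ((u ≟ v) ×-dec (degree G u ℕₚ.≟ 1))

    -- Only `v` changes degree. Having had degree at least 1, it is not a leaf afterwards, so a leaf
    -- is lost exactly when `v` was one.
    leaf-lost : ∀ u → 𝟙 (degree G⁺ (suc u) ℕₚ.≟ 1) + lost u ≡ 𝟙 (degree G u ℕₚ.≟ 1)
    leaf-lost u = go (u ≟ v)
      where
      go : Dec (u ≡ v) → 𝟙 (degree G⁺ (suc u) ℕₚ.≟ 1) + lost u ≡ 𝟙 (degree G u ℕₚ.≟ 1)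
      go (yes refl) = cong₂ _+_
        (𝟙-no (degree G⁺ (suc v) ℕₚ.≟ 1) λ deg⁺≡1 → ℕₚ.<⇒≢ 1≤deg (sym (ℕₚ.suc-injective (begin
          1 + degree G v             ≡⟨ cong (_+ degree G v) (𝟙-yes (v ≟ v) refl) ⟨
          𝟙 (v ≟ v) + degree G v     ≡⟨ degree-old v ⟨
          degree G⁺ (suc v)          ≡⟨ deg⁺≡1 ⟩
          1                          ∎))))
        (𝟙-cong ((v ≟ v) ×-dec (degree G v ℕₚ.≟ 1)) (degree G v ℕₚ.≟ 1) proj₂ (refl ,_))
        where open ≡-Reasoning
      go (no u≢v) = trans (cong₂ _+_
        (cong (λ d → 𝟙 (d ℕₚ.≟ 1)) (trans (degree-old u) (cong (_+ degree G u) (𝟙-no (u ≟ v) u≢v))))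
        (𝟙-no ((u ≟ v) ×-dec (degree G u ℕₚ.≟ 1)) (u≢v ∘ proj₁)))
        (ℕₚ.+-identityʳ _)

    numLeaves-lost : numLeaves G⁺ + sum lost ≡ 1 + numLeaves G
    numLeaves-lost = begin
      numLeaves G⁺ + sum lost
        ≡⟨ cong (_+ sum lost) (numLeaves≡sum G⁺) ⟩
      𝟙 (degree G⁺ 0F ℕₚ.≟ 1) + sum old + sum lost
        ≡⟨ cong (λ a → a + sum old + sum lost) (𝟙-yes (degree G⁺ 0F ℕₚ.≟ 1) degree-pendant) ⟩
      1 + (sum old + sum lost)
        ≡⟨ cong suc (∑-distrib-+ old lost) ⟨
      1 + sum (λ u → old u + lost u)
        ≡⟨ cong suc (sum-cong-≗ leaf-lost) ⟩
      1 + sum (λ u → 𝟙 (degree G u ℕₚ.≟ 1))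
        ≡⟨ cong suc (numLeaves≡sum G) ⟨
      1 + numLeaves G ∎
      where
      open ≡-Reasoning
      old : Fin n → ℕ
      old u = 𝟙 (degree G⁺ (suc u) ℕₚ.≟ 1)

    numLeaves-pendant : numLeaves G⁺ ≤ 1 + numLeaves G
    numLeaves-pendant = ℕₚ.≤-trans (ℕₚ.m≤m+n _ _) (ℕₚ.≤-reflexive numLeaves-lost)

  numLeaves-pendant-leaf : degree G v ≡ 1 → numLeaves G⁺ ≡ numLeaves G
  numLeaves-pendant-leaf deg≡1 = ℕₚ.+-cancelʳ-≡ 1 _ _ (begin
    numLeaves G⁺ + 1           ≡⟨ cong (numLeaves G⁺ +_) (sum-𝟙-unique (λ u → (u ≟ v) ×-dec (degree G u ℕₚ.≟ 1)) (refl , deg≡1) proj₁) ⟨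
    numLeaves G⁺ + _           ≡⟨ numLeaves-lost (ℕₚ.≤-reflexive (sym deg≡1)) ⟩
    1 + numLeaves G            ≡⟨ ℕₚ.+-comm 1 (numLeaves G) ⟩
    numLeaves G + 1            ∎)
    where open ≡-Reasoning

-- The field `served` makes the centres dominating. An inequality is enough for `count`, the reverse
-- being the lower bound.
record Attains (L : LabeledGraph n) : Set where
  open LabeledGraph L
  field
    served : ∀ v → Served L v (sta v)
    count  : 4 * numA L + numLeaves graph ≤ n + 3

-- The order grows by 1, the leaves by at most 1, and the centres stay the same.
attains-𝒪₁ : {L : LabeledGraph n} (v : Fin n) → LabeledGraph.sta L v ≡ A → Attains L → Attains (𝒪₁ L v)
attains-𝒪₁ {n = n} {L} v v-A att = record
  { served = λ where
      zero    → suc v , refl , v-A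
      (suc u) → served-map {L = L} {𝒪₁ L v} suc suc-injective id (λ _ → refl) (sta u) (served u)
  ; count  = begin
      4 * numA L + numLeaves (addPendant graph v)     ≤⟨ ℕₚ.+-monoʳ-≤ (4 * numA L) (numLeaves-pendant graph v
                                                           (degree≥1 graph (proj₂ (served⇒neighbour L (sta v) (served v))))) ⟩
      4 * numA L + suc (numLeaves graph)              ≡⟨ ℕₚ.+-suc (4 * numA L) (numLeaves graph) ⟩
      suc (4 * numA L + numLeaves graph)              ≤⟨ s≤s count ⟩
      suc n + 3                                       ∎
  }
  where
  open LabeledGraph L
  open Attains att
  open ℕₚ.≤-Reasoning

-- One new centre adds 4 on the left and four new vertices add 4 on the right. The number of leaves
-- is unchanged, as every new vertex is joined to a current leaf.
attains-𝒪₃ : {L : LabeledGraph n} (v : Fin n) → LabeledGraph.sta L v ≡ C → degree (LabeledGraph.graph L) v ≡ 1 →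
             Attains L → Attains (𝒪₃ L v)
attains-𝒪₃ {n = n} {L} v v-C v-leaf att = record
  { served = λ where
      0F → 1F , refl , refl
      1F → 0F , refl
      2F → 1F , refl , refl
      -- The vertex of status `D` lies between two centres: the new one, reached through `2F`, and
      -- the neighbour of status `A` that serves `v`.
      3F → let u , v~u , u-A = subst (Served L v) v-C (served v) in
           1F , old u , (λ ()) , (refl , 2F , refl , refl) , (u-A , old v , refl , v~u)
      (suc (suc (suc (suc u)))) →
        served-map {L = L} {𝒪₃ L v} old (λ { refl → refl }) id (λ _ → refl) (sta u) (served u)
  ; count  = begin
      4 * suc (numA L) + numLeaves (addPendant G₃ 0F)   ≡⟨ cong (4 * suc (numA L) +_) leaves-kept ⟩
      4 * suc (numA L) + numLeaves graph                ≡⟨ cong (_+ numLeaves graph) (ℕₚ.*-suc 4 (numA L)) ⟩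
      4 + (4 * numA L + numLeaves graph)                ≤⟨ ℕₚ.+-monoʳ-≤ 4 count ⟩
      4 + n + 3                                         ∎
  }
  where
  open LabeledGraph L
  open Attains att
  open ℕₚ.≤-Reasoning
  old : Fin n → Fin (4 + n)
  old u = suc (suc (suc (suc u)))
  G₁ = addPendant graph v
  G₂ = addPendant G₁ 0F
  G₃ = addPendant G₂ 0F
  leaves-kept : numLeaves (addPendant G₃ 0F) ≡ numLeaves graph
  leaves-kept =
    trans (numLeaves-pendant-leaf G₃ 0F (degree-pendant G₂ 0F))
    (trans (numLeaves-pendant-leaf G₂ 0F (degree-pendant G₁ 0F))
    (trans (numLeaves-pendant-leaf G₁ 0F (degree-pendant graph v))
           (numLeaves-pendant-leaf graph v v-leaf)))

attains-≅ : {L M : LabeledGraph n} → L ≅ M → Attains L → Attains M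
attains-≅ {n = n} {L} {M} L≅M att = record
  { served = λ v → subst (λ u → Served M u (sta M u)) (inverseʳ π) (served-image (π ⟨$⟩ˡ v))
  ; count  = begin
      4 * numA M + numLeaves (graph M)   ≡⟨ cong₂ (λ a l → 4 * a + l) numA-≡ numLeaves-≡ ⟩
      4 * numA L + numLeaves (graph L)   ≤⟨ count ⟩
      n + 3                              ∎
  }
  where
  open LabeledGraph
  open _≅_ L≅M
  open Attains att
  open ℕₚ.≤-Reasoning

  π-injective : ∀ {u v} → π ⟨$⟩ʳ u ≡ π ⟨$⟩ʳ v → u ≡ v
  π-injective eq = trans (sym (inverseˡ π)) (trans (cong (π ⟨$⟩ˡ_) eq) (inverseˡ π))

  served-image : ∀ v → Served M (π ⟨$⟩ʳ v) (sta M (π ⟨$⟩ʳ v))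
  served-image v = subst (Served M (π ⟨$⟩ʳ v)) (sym (sta-≡ v))
    (served-map {L = L} {M} (π ⟨$⟩ʳ_) π-injective (Equivalence.to (preserve _ _)) sta-≡ (sta L v) (served v))

  numA-≡ : numA M ≡ numA L
  numA-≡ = trans (∑-permute (λ v → 𝟙 (sta M v ≟A)) π) (sum-cong-≗ λ v → cong (λ s → 𝟙 (s ≟A)) (sta-≡ v))

  numLeaves-≡ : numLeaves (graph M) ≡ numLeaves (graph L)
  numLeaves-≡ = trans (numLeaves≡sum (graph M))
    (trans (∑-permute (λ v → 𝟙 (degree (graph M) v ℕₚ.≟ 1)) π)
    (trans (sum-cong-≗ λ v → cong (λ d → 𝟙 (d ℕₚ.≟ 1)) (sym (degree-permute {G = graph L} {graph M} π preserve v)))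
           (sym (numLeaves≡sum (graph L)))))

𝒯₁-attains : {L : LabeledGraph n} → 𝒯₁ L → Attains L
𝒯₁-attains base = record
  { served = λ { 0F → 1F , inj₁ refl , refl ; 1F → 0F , inj₂ refl ; 2F → 1F , inj₂ refl , refl }
  ; count  = ℕₚ.≤-refl
  }
𝒯₁-attains (step₁ v v-A L∈)        = attains-𝒪₁ v v-A (𝒯₁-attains L∈)
𝒯₁-attains (step₃ v v-C v-leaf L∈) = attains-𝒪₃ v v-C v-leaf (𝒯₁-attains L∈)
𝒯₁-attains (iso L≅M L∈)            = attains-≅ L≅M (𝒯₁-attains L∈)

-- The bound cleared of its denominator and of subtraction

module _ (γ n l : ℕ) where

  private
    bound : ℚᵘ
    -- The denominator is stored as its predecessor, so 3 stands for 4.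
    bound = mkℚᵘ (ℤ.+ n ℤ.- ℤ.+ l ℤ.+ ℤ.+ 3) 3

    -- `order` and `size` rewrite the two cross products in comparing the bound with γ/1 as a
    -- natural number minus `l`, so that the comparison descends to naturals.
    order : (ℤ.+ n ℤ.- ℤ.+ l ℤ.+ ℤ.+ 3) ℤ.* ℤ.+ 1 ≡ ℤ.+ (n + 3) ℤ.- ℤ.+ l
    order = rearrange (ℤ.+ n) (ℤ.+ l)
      where
      rearrange : ∀ a b → (a ℤ.- b ℤ.+ ℤ.+ 3) ℤ.* ℤ.+ 1 ≡ (a ℤ.+ ℤ.+ 3) ℤ.- b
      rearrange = RSℤ.solve-∀

    size : ℤ.+ γ ℤ.* ℤ.+ 4 ≡ ℤ.+ (4 * γ + l) ℤ.- ℤ.+ l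
    size = trans (rearrange (ℤ.+ γ) (ℤ.+ l))
                 (cong (λ x → x ℤ.+ ℤ.+ l ℤ.- ℤ.+ l) (sym (ℤₚ.pos-* 4 γ)))
      where
      rearrange : ∀ c b → c ℤ.* ℤ.+ 4 ≡ (ℤ.+ 4 ℤ.* c ℤ.+ b) ℤ.- b
      rearrange = RSℤ.solve-∀

  bound-≤ : n + 3 ≤ 4 * γ + l → ℤ.+ γ / 1 ≥ (ℤ.+ n ℤ.- ℤ.+ l ℤ.+ ℤ.+ 3) / 4
  bound-≤ n+3≤ = ℚₚ.toℚᵘ-cancel-≤
    (ℚᵘₚ.≤-respˡ-≃ (ℚᵘₚ.≃-sym (ℚₚ.toℚᵘ-fromℚᵘ bound))
    (ℚᵘₚ.≤-respʳ-≃ (ℚᵘₚ.≃-sym (ℚₚ.toℚᵘ-fromℚᵘ (mkℚᵘ (ℤ.+ γ) 0)))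
    (*≤* (subst₂ ℤ._≤_ (sym order) (sym size) (ℤₚ.+-monoˡ-≤ (ℤ.- ℤ.+ l) (ℤ.+≤+ n+3≤))))))

  bound-≡⁺ : 4 * γ + l ≡ n + 3 → ℤ.+ γ / 1 ≡ (ℤ.+ n ℤ.- ℤ.+ l ℤ.+ ℤ.+ 3) / 4
  bound-≡⁺ eq = ℚₚ.fromℚᵘ-cong {mkℚᵘ (ℤ.+ γ) 0} {bound}
    (*≡* (trans size (trans (cong (λ x → ℤ.+ x ℤ.- ℤ.+ l) eq) (sym order))))

  bound-≡⁻ : ℤ.+ γ / 1 ≡ (ℤ.+ n ℤ.- ℤ.+ l ℤ.+ ℤ.+ 3) / 4 → 4 * γ + l ≡ n + 3
  bound-≡⁻ eq with ℚₚ.fromℚᵘ-injective {mkℚᵘ (ℤ.+ γ) 0} {bound} eq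
  ... | *≡* cross = ℤₚ.+-injective
    (∙-cancelʳ (ℤ.- ℤ.+ l) _ _ (trans (sym size) (trans cross order)))
    where open import Algebra.Properties.Group (AbelianGroup.group ℤₚ.+-0-abelianGroup) using (∙-cancelʳ)

-- A minimum disjunctive dominating set of a nontrivial tree

first-step : (G : Graph n) {u v : Fin n} → u ≢ v → Walk G u v → ∃[ x ] Graph._~_ G u x
first-step G u≢u ε       = ⊥-elim (u≢u refl)
first-step G _   (e ◅ _) = _ , e

neighbour : (T : Graph n) → IsTree T → 2 ≤ n → ∀ v → ∃[ u ] Graph._~_ T v u
neighbour {n = suc zero}    T tree (s≤s ()) v
neighbour {n = suc (suc n)} T tree _        v with v ≟ 0F
... | yes refl = first-step T {v = 1F} (λ ()) (IsTree.connected tree 0F 1F)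
... | no  v≢0  = first-step T v≢0 (IsTree.connected tree v 0F)

module Bound (T : Graph n) (tree : IsTree T) (2≤n : 2 ≤ n) {γ : ℕ}
             (minimum : IsMinimum (SizeOfDisjunctiveDominatingSet T) γ) where
  private
    l = numLeaves T

  Δ : Subset n
  Δ = proj₁ (proj₁ minimum)

  dominating : IsDisjunctiveDominating T Δ
  dominating = proj₁ (proj₂ (proj₁ minimum))

  ∣Δ∣≡γ : ∣ Δ ∣ ≡ γ
  ∣Δ∣≡γ = proj₂ (proj₂ (proj₁ minimum))

  r : Fin n
  -- As `2 ≤ n` unfolds to `1 < n`, this is vertex 1; any vertex would serve.
  r = fromℕ< 2≤n

  open Discharging T Δ dominating (neighbour T tree 2≤n) using (cls; order-bound; extremal)
  open Handshake T tree using (handshake)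

  lower : n + 3 ≤ 4 * γ + l
  lower = subst (λ k → n + 3 ≤ 4 * k + l) ∣Δ∣≡γ (order-bound (handshake r))

  attained⇒𝒯₁ : 4 * γ + l ≡ n + 3 → ∃[ S ] 𝒯₁ ⟨ T , S ⟩
  attained⇒𝒯₁ eq = ExtremalTree.in-𝒯₁ T tree
    (extremal (handshake r) (ℕₚ.≤-reflexive (trans (cong (λ k → 4 * k + l) ∣Δ∣≡γ) eq)))
    (proj₂ (neighbour T tree 2≤n r))

  𝒯₁⇒attained : ∀ {S} → 𝒯₁ ⟨ T , S ⟩ → 4 * γ + l ≡ n + 3
  𝒯₁⇒attained {S} T∈𝒯₁ = ℕₚ.≤-antisym (begin
    4 * γ + l                     ≤⟨ ℕₚ.+-monoˡ-≤ l (ℕₚ.*-monoʳ-≤ 4 γ≤numA) ⟩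
    4 * numA ⟨ T , S ⟩ + l        ≤⟨ count ⟩
    n + 3                         ∎) lower
    where
    open ℕₚ.≤-Reasoning
    open Attains (𝒯₁-attains T∈𝒯₁)
    γ≤numA : γ ≤ numA ⟨ T , S ⟩
    γ≤numA = proj₂ minimum _ (centres ⟨ T , S ⟩ , centres-dominate ⟨ T , S ⟩ served , ∣comprehension∣ (λ v → S v ≟A))

open import Data.Integer.Base as ℤ using (+_)

theorem2p3 : (n : ℕ) (T : Graph n) → IsTree T → 2 ℕ.≤ n →
    ((+ γᵈ₂ T) / 1 ≥ (+ n ℤ.- + numLeaves T ℤ.+ + 3) / 4)
    × (((+ γᵈ₂ T) / 1 ≡ (+ n ℤ.- + numLeaves T ℤ.+ + 3) / 4)
    ⇔ (∃[ S ] 𝒯₁ ⟨ T , S ⟩))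
theorem2p3 n T tree 2≤n =
  bound-≤ γ n l lower , mk⇔ (attained⇒𝒯₁ ∘ bound-≡⁻ γ n l) (λ { (S , T∈𝒯₁) → bound-≡⁺ γ n l (𝒯₁⇒attained T∈𝒯₁) })
  where
  γ = γᵈ₂ T
  l = numLeaves T
  open Bound T tree 2≤n (γᵈ₂-isMinimum T)
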